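{- Let $n\ge 1$ and $1\le p\le n$ be integers. The number of $p$-toppleable configurations in $\mathcal{S}(n,p)$ equals $\tfrac12 B_{n-p+1,p}$.
   Context: Let $L_n=\{0,1,\dots,n+1\}$ be a set of sites on a line. $\mathcal{S}(n,p)$ ($1\le p\le n$) is the set of configurations of $n+1$ chips labeled $1,\dots,n+1$ on $L_n$ in which sites $1,\dots,n$ each carry exactly one chip, site $p$ carries one additional chip (so two chips), and sites $0,n+1$ are empty. Toppling: while some site holds at least two chips, choose such a site $i$ (uniformly at random), choose two chips $\alpha<\beta$ at site $i$, and move $\alpha$ to site $i-1$ and $\beta$ to site $i+1$. The process stays in $L_n$ and terminates in a final configuration, independent of the random choices, with exactly one chip on every site except one empty site; reading the chips from left to right (skipping the empty site) gives a permutation of $[n+1]$. A configuration $C\in\mathcal{S}(n,p)$ is $p$-toppleable if this final permutation is the identity $12\cdots(n+1)$ (the chips end up sorted). Poly-Bernoulli numbers of type B are defined for $k\ge0$ by $\sum_{n\ge0}B_{n,k}\frac{x^n}{n!}=\frac{\mathrm{Li}_{ -k}(1-e^{ -x})}{1-e^{ -x}}$, where $\mathrm{Li}_s(z)=\sum_{i\ge1}z^i/i^s$; equivalently $B_{n,k}=\sum_{m=0}^{\min(n,k)}(m!)^2\left\{{n+1\atop m+1}\right\}\left\{{k+1\atop m+1}\right\}$ with Stirling numbers of the second kind. -}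

module Defs where

open import Data.Nat using (ℕ; zero; suc; _+_; _*_; _∸_; _≤_; _<_; _⊓_; _≟_; _!)
open import Data.Nat.ListAction using (sum)
open import Data.Fin using (Fin) renaming (_<_ to _<ᶠ_)
open import Data.Vec using (Vec; lookup; toList; _[_]≔_)
open import Data.List using (List; length; filter; map; upTo)
open import Data.Product using (_×_; Σ; ∃; ∃-syntax)
open import Data.Bool using (if_then_else_)
open import Relation.Nullary using (¬_)
open import Relation.Nullary.Decidable using (⌊_⌋)
open import Relation.Binary.PropositionalEquality using (_≡_)
open import Relation.Binary.Construct.Closure.ReflexiveTransitive using (Star)

S2 : ℕ → ℕ → ℕ
S2 zero    zero    = 1
S2 zero    (suc k) = 0
S2 (suc n) zero    = 0
S2 (suc n) (suc k) = suc k * S2 n (suc k) + S2 n k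

polyBernoulliB : ℕ → ℕ → ℕ
polyBernoulliB n k =
  sum (map (λ m → (m !) * (m !) * S2 (suc n) (suc m) * S2 (suc k) (suc m))
           (upTo (suc (n ⊓ k))))

-- Chip configurations on L_n = {0,…,n+1} with n+1 labelled chips.
-- Chips are indexed by Fin (n+1) (chip c : Fin (n+1) is chip label c+1);
-- a configuration records, for each chip, the site (a natural number) it
-- occupies.

Config : ℕ → Set
Config n = Vec ℕ (suc n)

chipsAt : ∀ {n} → Config n → ℕ → ℕ
chipsAt C s = length (filter (λ x → x ≟ s) (toList C))

occupancy : ℕ → ℕ → ℕ
occupancy p s = if ⌊ s ≟ p ⌋ then 2 else 1

InS : (n p : ℕ) → Config n → Set
InS n p C =
  (∀ (c : Fin (suc n)) → 1 ≤ lookup C c × lookup C c ≤ n) ×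
  (∀ (s : ℕ) → 1 ≤ s → s ≤ n → chipsAt C s ≡ occupancy p s)

data Topple {n : ℕ} : Config n → Config n → Set where
  topple : (C : Config n) (i : ℕ) (α β : Fin (suc n)) →
           1 ≤ i → i ≤ n → α <ᶠ β →
           lookup C α ≡ i → lookup C β ≡ i →
           Topple C ((C [ α ]≔ (i ∸ 1)) [ β ]≔ suc i)

Stable : ∀ {n} → Config n → Set
Stable {n} C = ∀ (α β : Fin (suc n)) → ¬ (α ≡ β) → ¬ (lookup C α ≡ lookup C β)

Sorted : ∀ {n} → Config n → Set
Sorted {n} C = ∀ (α β : Fin (suc n)) → α <ᶠ β → lookup C α < lookup C β

-- p-toppleable: the (unique) final configuration reads as the identity.
Toppleable : (n : ℕ) → Config n → Set
Toppleable n C = ∃[ F ] (Star Topple C F × Stable F × Sorted F)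

{-# OPTIONS --safe #-}

-- Give every chip a slot: slot y on the left stands for site p − y, slot x on the
-- right for site p + x, so that site p offers two slots and a configuration of
-- 𝒮(n,p) is a bijection of chips and slots, up to exchanging the slots at p.
--
-- Let b(s) count the topplings of site s, normalised so that b is a lattice path
-- whose steps carry the chips: initially b(s) = s ∸ p, and toppling site s adds
-- one to b(s).  The condition that every chip c (counted from 0) at site s has
-- b(s) ≤ c and c + p + b(s) ≤ n + s is unchanged by a toppling in either direction,
-- and on a stable configuration it says that the chips are sorted.  At the start it
-- says y + c ≤ n for chips in a left slot and x ≤ c for chips in a right slot.
--
-- This only restricts the chips c ≤ n − p in right slots and the chips c > n − p in
-- left slots, each to a staircase board.  If m chips of each kind avoid their
-- staircase, the rook placements on the two staircases are counted by Stirling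
-- numbers, and the remaining chips of either kind fill the remaining slots of
-- either side in m! ways.  Exchanging the two slots at p gives the factor 2.

module Submission where

open import Defs
open import Data.Nat
open import Data.Nat.Properties
open import Data.Nat.ListAction using (sum)
open import Data.Fin.Base as Fin using (Fin; zero; suc; toℕ; fromℕ<; _↑ˡ_; _↑ʳ_; splitAt; opposite; punchOut)
import Data.Fin.Properties as Finₚ
open import Data.Fin.Permutation.Components using (transpose; transpose-inverse)
open import Data.List using (List; []; _∷_; _++_; length; filter; map; upTo)
open import Data.List.Properties using (length-++; filter-accept; filter-reject)
open import Data.List.Membership.Propositional using (_∈_)
open import Data.List.Membership.Propositional.Properties
open import Data.List.Membership.Propositional.Properties.WithK using (unique∧set⇒bag)
open import Data.List.Relation.Unary.Any using (here; there)
open import Data.List.Relation.Unary.All as All using ([]; _∷_)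
open import Data.List.Relation.Unary.AllPairs using ([]; _∷_)
open import Data.List.Relation.Unary.Unique.Propositional using (Unique)
import Data.List.Relation.Unary.Unique.Propositional.Properties as Uniqueₚ
open import Data.List.Relation.Binary.BagAndSetEquality using (∼bag⇒↭)
open import Data.List.Relation.Binary.Permutation.Propositional.Properties using (↭-length)
open import Data.Vec as Vec using (Vec; []; _∷_; lookup; tabulate)
import Data.Vec.Properties as Vecₚ
open import Data.Maybe using (Maybe; just; nothing)
open import Data.Product using (_×_; _,_; proj₁; proj₂; ∃; ∃₂; ∃-syntax; -,_; map₁; Σ)
open import Data.Sum as Sum using (_⊎_; inj₁; inj₂; [_,_]′)
import Data.Sum.Properties as Sumₚ
open import Data.Unit using (⊤; tt)
open import Data.Empty using (⊥; ⊥-elim)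
open import Function using (_∘_; id; _⇔_; mk⇔; Equivalence; case_of_)
open import Relation.Binary.Definitions using (tri<; tri≈; tri>)
open import Relation.Binary.PropositionalEquality
open import Relation.Binary.Construct.Closure.ReflexiveTransitive using (Star; ε; _◅_)
open import Relation.Nullary using (¬_; Dec; yes; no)
open import Relation.Nullary.Decidable using (¬?; _×-dec_)
open import Relation.Unary using (Decidable)

-- Exact enumerations of predicates and their arithmetic

-- A cardinality with its witness: the listing is part of the data because the theorem has to
-- exhibit one.
record Enum {A : Set} (P : A → Set) (k : ℕ) : Set where
  constructor enum
  field
    elems    : List A
    unique   : Unique elems
    sound    : ∀ {x} → x ∈ elems → P x
    complete : ∀ {x} → P x → x ∈ elems
    size     : length elems ≡ k

module _ {A : Set} {P Q : A → Set} where

  enum-resp : (∀ {x} → P x → Q x) → (∀ {x} → Q x → P x) → ∀ {k} → Enum P k → Enum Q k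
  enum-resp f g (enum xs u s c z) = enum xs u (f ∘ s) (c ∘ g) z

  enum-⊎ : (∀ {x} → P x → ¬ Q x) → ∀ {k l} → Enum P k → Enum Q l →
           Enum (λ x → P x ⊎ Q x) (k + l)
  enum-⊎ disj (enum xs u s c z) (enum ys u′ s′ c′ z′) = enum (xs ++ ys)
    (Uniqueₚ.++⁺ u u′ (λ (p , q) → disj (s p) (s′ q)))
    (λ x∈ → Sum.map s s′ (∈-++⁻ xs x∈))
    [ ∈-++⁺ˡ ∘ c , ∈-++⁺ʳ xs ∘ c′ ]′
    (trans (length-++ xs) (cong₂ _+_ z z′))

  enum-filter : Decidable Q → ∀ {k} → Enum P k → ∃ (Enum (λ x → P x × Q x))
  enum-filter Q? (enum xs u s c _) = -, enum (filter Q? xs) (Uniqueₚ.filter⁺ Q? u)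
    (λ x∈ → map₁ s (∈-filter⁻ Q? x∈)) (λ (p , q) → ∈-filter⁺ Q? (c p) q) refl

module _ {A : Set} where

  enum-⊥ : Enum {A} (λ _ → ⊥) 0
  enum-⊥ = enum [] [] (λ ()) (λ ()) refl

  enum-singleton : (a : A) → Enum (_≡ a) 1
  enum-singleton a = enum (a ∷ []) ([] ∷ []) (λ { (here eq) → eq }) here refl

  -- Duplicate-free lists with the same members are permutations of each other. Unknown sizes are
  -- found below by enumerating one predicate in two ways.
  enum-unique : {P : A → Set} {k l : ℕ} → Enum P k → Enum P l → k ≡ l
  enum-unique (enum xs u s c z) (enum ys u′ s′ c′ z′) = trans (sym z) (trans
    (↭-length (∼bag⇒↭ (unique∧set⇒bag u u′ (mk⇔ (c′ ∘ s) (c ∘ s′))))) z′)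

  enum-insert : {P : A → Set} {k : ℕ} (a : A) → ¬ P a → Enum P k →
                Enum (λ x → x ≡ a ⊎ P x) (suc k)
  enum-insert a ¬Pa = enum-⊎ (λ { refl → ¬Pa }) (enum-singleton a)

  enum-remove : (∀ (x y : A) → Dec (x ≡ y)) → {P : A → Set} {k : ℕ} {a : A} → P a →
                Enum P (suc k) → Enum (λ x → P x × x ≢ a) k
  enum-remove _≟ᴬ_ {P} {k} {a} Pa E with enum-filter (λ x → ¬? (x ≟ᴬ a)) E
  -- Putting `a` back into the filtered list enumerates `P` again, which forces `suc j ≡ suc k`.
  ... | j , E′ = subst (Enum _) (suc-injective (enum-unique
    (enum-resp {Q = P} [ (λ { refl → Pa }) , proj₁ ]′ split (enum-insert a (λ (_ , a≢a) → a≢a refl) E′)) E)) E′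
    where
    split : ∀ {x} → P x → x ≡ a ⊎ (P x × x ≢ a)
    split {x} Px with x ≟ᴬ a
    ... | yes eq = inj₁ eq
    ... | no  ne = inj₂ (Px , ne)

  enum-partition : {P Q : A → Set} → Decidable Q → ∀ {k} → Enum P k →
    ∃₂ λ i j → Enum (λ x → P x × Q x) i × Enum (λ x → P x × ¬ Q x) j × i + j ≡ k
  enum-partition {P} {Q} Q? E with enum-filter Q? E | enum-filter (¬? ∘ Q?) E
  ... | i , E₁ | j , E₂ = i , j , E₁ , E₂ ,
    enum-unique (enum-resp {Q = P} [ proj₁ , proj₁ ]′ split
                  (enum-⊎ (λ (_ , q) (_ , ¬q) → ¬q q) E₁ E₂)) E
    where
    split : ∀ {x} → P x → (P x × Q x) ⊎ (P x × ¬ Q x)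
    split {x} Px with Q? x
    ... | yes q = inj₁ (Px , q)
    ... | no ¬q = inj₂ (Px , ¬q)

  enum-0 : {P : A → Set} → Enum P 0 → ∀ {x} → ¬ P x
  enum-0 (enum [] _ _ c _) Px with c Px
  ... | ()

module _ {A B : Set} {Q : A → B → Set}
         (functional : ∀ {x x′ z} → Q x z → Q x′ z → x ≡ x′) where

  -- By `functional` the fibres over different `x` are disjoint, so their sizes add up.
  enum-sum : (xs : List A) → Unique xs → (f : A → ℕ) → (∀ {x} → x ∈ xs → Enum (Q x) (f x)) →
             Enum (λ z → ∃[ x ] (x ∈ xs × Q x z)) (sum (map f xs))
  enum-sum [] u f E = enum [] [] (λ ()) (λ ()) refl
  enum-sum (x ∷ xs) (x∉ ∷ u) f E = enum-resp
    [ (λ q → x , here refl , q) , (λ (y , y∈ , q) → y , there y∈ , q) ]′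
    (λ { (_ , here refl , q) → inj₁ q ; (y , there y∈ , q) → inj₂ (y , y∈ , q) })
    (enum-⊎ (λ q (y , y∈ , q′) → All.lookup x∉ y∈ (functional q q′))
      (E (here refl)) (enum-sum xs u f (E ∘ there)))

  -- A product rule for dependent choices: the second choice may range over a set that varies with
  -- the first, as long as its size does not.
  enum-bind : {P : A → Set} {k l : ℕ} → Enum P k → (∀ {x} → P x → Enum (Q x) l) →
              Enum (λ z → ∃[ x ] (P x × Q x z)) (k * l)
  enum-bind {P} {k} {l} (enum xs u s c z) E = subst (Enum _) (trans (sum-const xs) (cong (_* l) z))
    (enum-resp (λ (x , x∈ , q) → x , s x∈ , q) (λ (x , p , q) → x , c p , q)
      (enum-sum xs u (λ _ → l) (E ∘ s)))
    where
    sum-const : ∀ ys → sum (map (λ _ → l) ys) ≡ length ys * l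
    sum-const []       = refl
    sum-const (_ ∷ ys) = cong (l +_) (sum-const ys)

module _ {A B : Set} {P : A → Set} (f : A → B) where

  enum-map : (∀ {x x′} → P x → P x′ → f x ≡ f x′ → x ≡ x′) → ∀ {k} → Enum P k →
             Enum (λ z → ∃[ x ] (P x × z ≡ f x)) k
  enum-map inj {k} E = subst (Enum _) (*-identityʳ k) (enum-resp
    (λ (x , Px , _ , eq) → x , Px , eq) (λ (x , Px , eq) → x , Px , Px , eq)
    (enum-bind {Q = λ x z → P x × z ≡ f x}
      (λ (p , eq) (p′ , eq′) → inj p p′ (trans (sym eq) eq′)) E
      (λ {x} Px → enum-resp (λ eq → Px , eq) proj₂ (enum-singleton (f x)))))

enum-× : ∀ {A B : Set} {P : A → Set} {Q : B → Set} {k l} → Enum P k → Enum Q l →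
         Enum (λ (x , y) → P x × Q y) (k * l)
enum-× E E′ = enum-resp
  (λ { (_ , p , _ , q , refl) → p , q }) (λ (p , q) → _ , p , _ , q , refl)
  (enum-bind (λ { (_ , _ , refl) (_ , _ , refl) → refl }) E
    (λ {x} _ → enum-map (x ,_) (λ { _ _ refl → refl }) E′))

-- Counting matched halves

-- Each half of the chips has its own side of site p, restricted to a staircase:
-- inj₁ x is slot x on that side, inj₂ y slot y on the other side.
Slot : Set
Slot = ℕ ⊎ ℕ

own : Slot → Maybe ℕ
own (inj₁ x) = just x
own (inj₂ _) = nothing

Used : ∀ {t} → Vec (Maybe ℕ) t → ℕ → Set
Used a x = ∃[ i ] lookup a i ≡ just x

Free : ∀ {t} → Vec (Maybe ℕ) t → ℕ → Set
Free {t} a x = x < t × ¬ Used a x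

Candidate : ∀ {t} → Vec (Maybe ℕ) t → ℕ → Set
Candidate {t} a x = x ≤ t × ¬ Used a x

-- Rook placements on a staircase: the row above t rows has columns 0,…,t, and
-- m counts the rows left empty.
data Shape : (t m : ℕ) → Vec (Maybe ℕ) t → Set where
  []   : Shape 0 0 []
  skip : ∀ {t m a} → Shape t m a → Shape (suc t) (suc m) (nothing ∷ a)
  put  : ∀ {t m a x} → Candidate a x → Shape t m a → Shape (suc t) m (just x ∷ a)

used-bound : ∀ {t m a x} → Shape t m a → Used a x → x < t
used-bound (skip s)          (suc i , eq)   = m<n⇒m<1+n (used-bound s (i , eq))
used-bound (put (x≤t , _) s) (zero  , refl) = s≤s x≤t
used-bound (put _ s)         (suc i , eq)   = m<n⇒m<1+n (used-bound s (i , eq))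

holes-bound : ∀ {t m a} → Shape t m a → m ≤ t
holes-bound []        = z≤n
holes-bound (skip s)  = s≤s (holes-bound s)
holes-bound (put _ s) = m≤n⇒m≤1+n (holes-bound s)

-- Each nonempty row uses up one of the `t` columns, which leaves as many as there are empty rows. A
-- row on top also has the new column `t`, hence one candidate more.
enum-free : ∀ {t m a} → Shape t m a → Enum (Free a) m
enum-candidate : ∀ {t m a} → Shape t m a → Enum (Candidate a) (suc m)

enum-free [] = enum-resp (λ ()) (λ ()) enum-⊥
enum-free (skip s) = enum-resp
  (λ (x≤t , free) → s≤s x≤t , λ { (suc i , eq) → free (i , eq) })
  (λ (x<1+t , free) → s≤s⁻¹ x<1+t , λ (i , eq) → free (suc i , eq))
  (enum-candidate s)
enum-free (put c s) = enum-resp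
  (λ ((x≤t , free) , x≢y) → s≤s x≤t , λ { (zero , refl) → x≢y refl ; (suc i , eq) → free (i , eq) })
  (λ (x<1+t , free) → (s≤s⁻¹ x<1+t , λ (i , eq) → free (suc i , eq)) , λ { refl → free (zero , refl) })
  (enum-remove _≟_ c (enum-candidate s))

enum-candidate {t} {a = a} s = enum-resp
  [ (λ { refl → ≤-refl , <-irrefl refl ∘ used-bound s }) , map₁ <⇒≤ ]′
  (λ (x≤t , free) → [ (λ x<t → inj₂ (x<t , free)) , inj₁ ]′ (m≤n⇒m<n∨m≡n x≤t))
  (enum-insert t (<-irrefl refl ∘ proj₁) (enum-free s))

holes-unique : ∀ {t m m′ a} → Shape t m a → Shape t m′ a → m ≡ m′
holes-unique s s′ = enum-unique (enum-free s) (enum-free s′)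

enum-put : ∀ {t m k} → Enum (Shape t m) k →
           Enum (λ z → ∃[ a ] (Shape t m a × ∃[ x ] (Candidate a x × z ≡ just x ∷ a))) (k * suc m)
enum-put E = enum-bind
  (λ { (_ , _ , refl) (_ , _ , refl) → refl }) E
  (λ s → enum-map (λ x → just x ∷ _) (λ { _ _ refl → refl }) (enum-candidate s))

-- Above a placement with `m` empty rows, the next row is filled in `suc m` ways or left empty. This
-- is the recurrence of the Stirling numbers of the second kind, with both indices shifted by one.
enum-shape : ∀ t m → Enum (Shape t m) (S2 (suc t) (suc m))
enum-shape zero zero = enum-resp (λ { refl → [] }) (λ { [] → refl }) (enum-singleton [])
enum-shape zero (suc m) = subst (Enum _) (sym (trans (+-identityʳ _) (*-zeroʳ m)))
  (enum-resp (λ ()) (λ ()) enum-⊥)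
-- With no empty row only `put` is possible, in agreement with `S2 (suc t) 0` being 0.
enum-shape (suc t) zero = subst (Enum _) (trans (*-comm (S2 (suc t) 1) 1) (sym (+-identityʳ _)))
  (enum-resp
    (λ { (_ , s , _ , c , refl) → put c s })
    (λ { (put c s) → _ , s , _ , c , refl })
    (enum-put (enum-shape t zero)))
enum-shape (suc t) (suc m) = subst (λ k → Enum (Shape (suc t) (suc m)) (k + S2 (suc t) (suc m)))
  (*-comm (S2 (suc t) (suc (suc m))) (suc (suc m)))
  (enum-resp
    [ (λ { (_ , s , _ , c , refl) → put c s }) , (λ { (_ , s , refl) → skip s }) ]′
    (λ { (put c s) → inj₁ (_ , s , _ , c , refl) ; (skip s) → inj₂ (_ , s , refl) })
    (enum-⊎ (λ { (_ , _ , _ , _ , refl) (_ , _ , ()) })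
      (enum-put (enum-shape t (suc m)))
      (enum-map (nothing ∷_) (λ { _ _ refl → refl }) (enum-shape t m))))

-- The empty rows of a receive distinct elements of F.
Fill : ∀ {t} → (ℕ → Set) → Vec (Maybe ℕ) t → Vec Slot t → Set
Fill F []            []           = ⊤
Fill F (just x ∷ a)  (inj₁ y ∷ u) = x ≡ y × Fill F a u
Fill F (nothing ∷ a) (inj₂ y ∷ u) = F y × Fill (λ z → F z × z ≢ y) a u
Fill F _             _            = ⊥

-- The first empty row takes any element of `F`; removing that element leaves one fewer for the
-- remaining empty rows.
enum-fill : ∀ {t m a F} → Shape t m a → Enum F m → Enum (Fill F a) (m !)
enum-fill [] E = enum-resp (λ { refl → tt }) (λ { {[]} _ → refl }) (enum-singleton [])
enum-fill (skip {m = m} {a} s) E = enum-resp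
  (λ { (_ , Fy , _ , fill , refl) → Fy , fill })
  (λ { {inj₂ y ∷ u} (Fy , fill) → y , Fy , u , fill , refl })
  (enum-bind (λ { (_ , _ , refl) (_ , _ , refl) → refl }) E
    (λ Fy → enum-map (inj₂ _ ∷_) (λ { _ _ refl → refl }) (enum-fill s (enum-remove _≟_ Fy E))))
enum-fill (put {x = x} _ s) E = enum-resp
  (λ { (_ , fill , refl) → refl , fill })
  (λ { {inj₁ _ ∷ u} (refl , fill) → u , fill , refl })
  (enum-map (inj₁ x ∷_) (λ { _ _ refl → refl }) (enum-fill s E))

-- The slot vector remembers its shape, so fillings of different shapes never coincide.
fill-own : ∀ {t F} (a : Vec (Maybe ℕ) t) u → Fill F a u → a ≡ Vec.map own u
fill-own []            []           _             = refl
fill-own (just x ∷ a)  (inj₁ y ∷ u) (refl , fill) = cong (_ ∷_) (fill-own a u fill)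
fill-own (nothing ∷ a) (inj₂ y ∷ u) (_ , fill)    = cong (_ ∷_) (fill-own a u fill)

-- Pigeonhole: the empty rows take distinct elements of `F`.
fill-count : ∀ {t m k a F u} → Shape t m a → Enum F k → Fill F a u → m ≤ k
fill-count [] E _ = z≤n
fill-count {k = zero}  {u = inj₂ y ∷ u} (skip s) E (Fy , _)    = ⊥-elim (enum-0 E Fy)
fill-count {k = suc k} {u = inj₂ y ∷ u} (skip s) E (Fy , fill) =
  s≤s (fill-count s (enum-remove _≟_ Fy E) fill)
fill-count {u = inj₁ y ∷ u} (put _ s) E (_ , fill) = fill-count s E fill

InjectiveVec : ∀ {A : Set} {t} → Vec A t → Set
InjectiveVec u = ∀ {i j} → lookup u i ≡ lookup u j → i ≡ j

injective-tail : ∀ {A : Set} {t x} {u : Vec A t} → InjectiveVec (x ∷ u) → InjectiveVec u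
injective-tail inj eq = Finₚ.suc-injective (inj eq)

-- Row `i` from the top has `t - 1 - i` rows beneath it, so this is the staircase of `Shape` in
-- terms of positions.
Bounded : ∀ {t} → Vec Slot t → Set
Bounded {t} u = ∀ {i x} → lookup u i ≡ inj₁ x → x + toℕ i < t

suc-index : ∀ x i {t} → x + i < t → x + suc i < suc t
suc-index x i {t} = subst (_< suc t) (sym (+-suc x i)) ∘ s<s

pred-index : ∀ x i {t} → x + suc i < suc t → x + i < t
pred-index x i {t} = s<s⁻¹ ∘ subst (_< suc t) (+-suc x i)

bounded-tail : ∀ {t x} {u : Vec Slot t} → Bounded (x ∷ u) → Bounded u
bounded-tail b {i} {x} eq = pred-index x (toℕ i) (b {suc i} eq)

lookup-own : ∀ {t} (u : Vec Slot t) {i x} → lookup (Vec.map own u) i ≡ just x → lookup u i ≡ inj₁ x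
lookup-own (inj₁ _ ∷ u) {zero}  refl = refl
lookup-own (_ ∷ u)      {suc i} eq   = lookup-own u eq

own-lookup : ∀ {t} (u : Vec Slot t) {i x} → lookup u i ≡ inj₁ x → lookup (Vec.map own u) i ≡ just x
own-lookup u {i} eq = trans (Vecₚ.lookup-map i own u) (cong own eq)

injective⇒shape : ∀ {t} (u : Vec Slot t) → Bounded u → InjectiveVec u →
                  ∃[ m ] Shape t m (Vec.map own u)
injective⇒shape [] b inj = 0 , []
injective⇒shape (inj₂ y ∷ u) b inj
  with m , s ← injective⇒shape u (bounded-tail {x = inj₂ y} b) (injective-tail inj) = suc m , skip s
injective⇒shape (inj₁ x ∷ u) b inj
  with m , s ← injective⇒shape u (bounded-tail {x = inj₁ x} b) (injective-tail inj) =
  m , put (s≤s⁻¹ (subst (λ y → suc y ≤ _) (+-identityʳ x) (b {zero} refl)) ,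
           λ (i , eq) → case inj {zero} {suc i} (sym (lookup-own u eq)) of λ ()) s

others⇒fill : ∀ {t F} (u : Vec Slot t) → InjectiveVec u →
              (∀ {i y} → lookup u i ≡ inj₂ y → F y) → Fill F (Vec.map own u) u
others⇒fill [] inj f = tt
others⇒fill (inj₁ x ∷ u) inj f = refl , others⇒fill u (injective-tail inj) (λ {i} → f {suc i})
others⇒fill (inj₂ y ∷ u) inj f = f {zero} refl , others⇒fill u (injective-tail inj)
  (λ {i} eq → f {suc i} eq , λ { refl → case inj {zero} {suc i} (sym eq) of λ () })

fill⇒others : ∀ {t F} (a : Vec (Maybe ℕ) t) u → Fill F a u → ∀ {i y} → lookup u i ≡ inj₂ y → F y
fill⇒others (just _ ∷ a)  (inj₁ _ ∷ u) (_ , fill)  {suc i} eq   = fill⇒others a u fill eq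
fill⇒others (nothing ∷ a) (inj₂ _ ∷ u) (Fy , fill) {zero}  refl = Fy
fill⇒others (nothing ∷ a) (inj₂ _ ∷ u) (Fy , fill) {suc i} eq   = proj₁ (fill⇒others a u fill eq)

shape⇒bounded : ∀ {t m} (u : Vec Slot t) → Shape t m (Vec.map own u) → Bounded u
shape⇒bounded (inj₁ x ∷ u) (put (x≤t , _) s) {zero} refl =
  s≤s (subst (_≤ _) (sym (+-identityʳ x)) x≤t)
shape⇒bounded (inj₁ _ ∷ u) (put _ s) {suc i} {x} eq =
  suc-index x (toℕ i) (shape⇒bounded u s eq)
shape⇒bounded (inj₂ _ ∷ u) (skip s) {suc i} {x} eq =
  suc-index x (toℕ i) (shape⇒bounded u s eq)

fill⇒injective : ∀ {t m F} (u : Vec Slot t) → Shape t m (Vec.map own u) → Fill F (Vec.map own u) u →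
                 InjectiveVec u
fill⇒injective (x ∷ u) s fill {zero} {zero} eq = refl
fill⇒injective (inj₁ x ∷ u) (put (_ , unused) s) fill {zero} {suc j} eq =
  ⊥-elim (unused (j , own-lookup u (sym eq)))
fill⇒injective (inj₂ y ∷ u) (skip s) (_ , fill) {zero} {suc j} eq =
  ⊥-elim (proj₂ (fill⇒others _ u fill {j} (sym eq)) refl)
fill⇒injective (inj₁ x ∷ u) (put (_ , unused) s) fill {suc j} {zero} eq =
  ⊥-elim (unused (j , own-lookup u eq))
fill⇒injective (inj₂ y ∷ u) (skip s) (_ , fill) {suc j} {zero} eq =
  ⊥-elim (proj₂ (fill⇒others _ u fill {j} eq) refl)
fill⇒injective (inj₁ x ∷ u) (put _ s) (_ , fill) {suc i} {suc j} eq =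
  cong suc (fill⇒injective u s fill eq)
fill⇒injective (inj₂ x ∷ u) (skip s) (_ , fill) {suc i} {suc j} eq =
  cong suc (fill⇒injective u s fill eq)

-- By `other`, a row that leaves its own side lands in a column that no row of `v` occupies as its
-- own. Hence the two halves of a matched pair share no slot.
record Half {t s : ℕ} (u : Vec Slot t) (v : Vec Slot s) : Set where
  constructor half
  field
    bounded   : Bounded u
    injective : InjectiveVec u
    other     : ∀ {i y} → lookup u i ≡ inj₂ y → Free (Vec.map own v) y

Matched : ∀ {t s} → Vec Slot t × Vec Slot s → Set
Matched (u , v) = Half u v × Half v u

MatchedShape : (t s m : ℕ) → Vec Slot t × Vec Slot s → Set
MatchedShape t s m (u , v) =
  ∃[ ab ] ((Shape t m (proj₁ ab) × Shape s m (proj₂ ab)) ×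
           (Fill (Free (proj₂ ab)) (proj₁ ab) u × Fill (Free (proj₁ ab)) (proj₂ ab) v))

matchedShape-functional : ∀ {t s m m′ uv} → MatchedShape t s m uv → MatchedShape t s m′ uv → m ≡ m′
matchedShape-functional {uv = u , v} ((a , b) , (sa , _) , fa , _) ((a′ , b′) , (sa′ , _) , fa′ , _)
  with fill-own a u fa | fill-own a′ u fa′
... | refl | refl = holes-unique sa sa′

enum-matchedShape : ∀ t s m →
  Enum (MatchedShape t s m) (m ! * m ! * S2 (suc t) (suc m) * S2 (suc s) (suc m))
enum-matchedShape t s m = subst (Enum _)
  (trans (*-comm (S2 (suc t) (suc m) * S2 (suc s) (suc m)) (m ! * m !))
         (sym (*-assoc (m ! * m !) (S2 (suc t) (suc m)) (S2 (suc s) (suc m)))))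
  (enum-bind
    (λ { {a , b} {a′ , b′} {u , v} (f , g) (f′ , g′) →
       cong₂ _,_ (trans (fill-own a u f) (sym (fill-own a′ u f′)))
                 (trans (fill-own b v g) (sym (fill-own b′ v g′))) })
    (enum-× (enum-shape t m) (enum-shape s m))
    (λ (sa , sb) → enum-× (enum-fill sa (enum-free sb)) (enum-fill sb (enum-free sa))))

enum-matched : ∀ t s → Enum (Matched {t} {s}) (polyBernoulliB t s)
enum-matched t s = enum-resp to from
  (enum-sum matchedShape-functional (upTo (suc (t ⊓ s))) (Uniqueₚ.upTo⁺ _) _
    (λ {m} _ → enum-matchedShape t s m))
  where
  to : ∀ {uv} → ∃[ m ] (m ∈ upTo (suc (t ⊓ s)) × MatchedShape t s m uv) → Matched uv
  to {u , v} (_ , _ , (a , b) , (sa , sb) , fa , fb)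
    with refl ← fill-own a u fa | refl ← fill-own b v fb =
    half (shape⇒bounded u sa) (fill⇒injective u sa fa) (fill⇒others _ u fa) ,
    half (shape⇒bounded v sb) (fill⇒injective v sb fb) (fill⇒others _ v fb)

  from : ∀ {uv} → Matched uv → ∃[ m ] (m ∈ upTo (suc (t ⊓ s)) × MatchedShape t s m uv)
  from {u , v} (half bu iu ou , half bv iv ov)
    with m , sa ← injective⇒shape u bu iu | m′ , sb ← injective⇒shape v bv iv
    with fa ← others⇒fill u iu ou | fb ← others⇒fill v iv ov
    -- The empty rows of either half inject into the free columns of the other, which are as many as
    -- the other's empty rows; hence `m ≡ m′`.
    with refl ← ≤-antisym (fill-count sa (enum-free sb) fa) (fill-count sb (enum-free sa) fb) =
    m , ∈-upTo⁺ (s≤s (⊓-glb (holes-bound sa) (holes-bound sb))) , _ , (sa , sb) , fa , fb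

-- Pigeonhole, lattice paths and downward induction

injective⇒surjective : ∀ {n} (f : Fin (suc n) → ℕ) → (∀ {c d} → f c ≡ f d → c ≡ d) →
                       (∀ c → f c ≤ n) → ∀ {s} → s ≤ n → ∃[ c ] f c ≡ s
injective⇒surjective {n} f inj f≤n {s} s≤n with Finₚ.any? (λ c → f c ≟ s)
... | yes hit = hit
-- Punching out a missed value `s` would inject `Fin (suc n)` into `Fin n`.
... | no miss = ⊥-elim (<-irrefl refl (Finₚ.injective⇒≤ {f = g} g-injective))
  where
  fin : ∀ c → Fin (suc n)
  fin c = fromℕ< (s≤s (f≤n c))

  target≢ : ∀ c → fromℕ< (s≤s s≤n) ≢ fin c
  target≢ c eq = miss (c , sym (Finₚ.fromℕ<-injective _ _ (s≤s s≤n) (s≤s (f≤n c)) eq))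

  g : Fin (suc n) → Fin n
  g c = punchOut (target≢ c)

  g-injective : ∀ {c d} → g c ≡ g d → c ≡ d
  g-injective {c} {d} eq = inj (Finₚ.fromℕ<-injective _ _ (s≤s (f≤n c)) (s≤s (f≤n d))
    (Finₚ.punchOut-injective (target≢ c) (target≢ d) eq))

-- The path b has a step over every edge (e , e + 1), and the chip on that step
-- stands at its lower end: at e if the step goes up, at e + 1 if it is level.
-- (Lower in the height function 2 b(s) − s, for which a level step descends.)
Located : (ℕ → ℕ) → (site edge : ℕ) → Set
Located b s e = (s ≡ e × b (suc e) ≡ suc (b e)) ⊎ (s ≡ suc e × b (suc e) ≡ b e)

bump : ℕ → (ℕ → ℕ) → ℕ → ℕ
bump i b s with s ≟ i
... | yes _ = suc (b s)
... | no  _ = b s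

bump-≡ : ∀ i b → bump i b i ≡ suc (b i)
bump-≡ i b with i ≟ i
... | yes _  = refl
... | no i≢i = ⊥-elim (i≢i refl)

bump-≢ : ∀ {i s} b → s ≢ i → bump i b s ≡ b s
bump-≢ {i} {s} b s≢i with s ≟ i
... | yes eq = ⊥-elim (s≢i eq)
... | no _   = refl

-- The potential for termination: over the sites `0` to `n` it grows by one with every toppling and
-- stays at most `total id`, because a valid path has `b s ≤ s`.
total : (ℕ → ℕ) → ℕ → ℕ
total b zero    = 0
total b (suc k) = b k + total b k

total-cong : ∀ {b b′} k → (∀ {s} → s < k → b s ≡ b′ s) → total b k ≡ total b′ k
total-cong zero    eq = refl
total-cong (suc k) eq = cong₂ _+_ (eq ≤-refl) (total-cong k (eq ∘ m<n⇒m<1+n))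

total-mono : ∀ {b b′} k → (∀ {s} → s < k → b s ≤ b′ s) → total b k ≤ total b′ k
total-mono zero    le = z≤n
total-mono (suc k) le = +-mono-≤ (le ≤-refl) (total-mono k (le ∘ m<n⇒m<1+n))

total-bump : ∀ {i} b {k} → i < k → total (bump i b) k ≡ suc (total b k)
total-bump {i} b {suc k} i<1+k with m≤n⇒m<n∨m≡n (s≤s⁻¹ i<1+k)
... | inj₂ refl = cong₂ _+_ (bump-≡ i b) (total-cong i (bump-≢ b ∘ <⇒≢))
... | inj₁ i<k  = trans (cong₂ _+_ (bump-≢ b (<⇒≢ i<k ∘ sym)) (total-bump b i<k)) (+-suc (b k) _)

descend : ∀ {n} (P : ℕ → Set) → (∀ {s} → s ≤ n → (∀ {t} → s < t → t ≤ n → P t) → P s) →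
          ∀ {s} → s ≤ n → P s
descend {n} P step {s} s≤n = go (n ∸ s) s≤n ≤-refl
  where
  go : ∀ k {s} → s ≤ n → n ∸ s ≤ k → P s
  go zero    s≤n le = step s≤n (λ s<t t≤n → ⊥-elim (<-irrefl refl
    (<-≤-trans s<t (≤-trans t≤n (m∸n≡0⇒m≤n (n≤0⇒n≡0 le))))))
  go (suc k) s≤n le = step s≤n (λ s<t t≤n → go k t≤n (s≤s⁻¹ (<-≤-trans (∸-monoʳ-< s<t t≤n) le)))

-- Toppling

module Dynamics (r p : ℕ) where

  n : ℕ
  n = r + p

  -- With `n + 1` chips and `n + 1` edges, `edge` is a bijection. The end values are those of the
  -- initial path `s ∸ p`; topplings never touch them.
  record Valid (C : Config n) (b : ℕ → ℕ) : Set where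
    field
      edge    : Fin (suc n) → ℕ
      inj     : ∀ {c d} → edge c ≡ edge d → c ≡ d
      edge≤n  : ∀ c → edge c ≤ n
      start   : b 0 ≡ 0
      end     : b (suc n) ≡ suc r
      located : ∀ c → Located b (lookup C c) (edge c)

    occupied : ∀ {s} → s ≤ n → ∃[ c ] edge c ≡ s
    occupied = injective⇒surjective edge inj edge≤n

    step : ∀ {s} → s ≤ n → b (suc s) ≡ suc (b s) ⊎ b (suc s) ≡ b s
    step s≤n with occupied s≤n
    ... | c , refl = Sum.map proj₂ proj₂ (located c)

    b≤ : ∀ {s} → s ≤ suc n → b s ≤ s
    b≤ {zero} _ = ≤-reflexive start
    b≤ {suc s} (s≤s s≤n) with step s≤n
    ... | inj₁ up   = ≤-trans (≤-reflexive up) (s≤s (b≤ (m≤n⇒m≤1+n s≤n)))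
    ... | inj₂ down = ≤-trans (≤-reflexive down) (m≤n⇒m≤1+n (b≤ (m≤n⇒m≤1+n s≤n)))

  open Valid

  Balanced : Config n → (ℕ → ℕ) → Set
  Balanced C b = ∀ c → b (lookup C c) ≤ toℕ c × toℕ c + p + b (lookup C c) ≤ n + lookup C c

  -- `Located` depends on a chip only through its site, so chips standing together may trade edges.
  exchange : ∀ {C b} (V : Valid C b) (α β : Fin (suc n)) → lookup C α ≡ lookup C β →
             Σ (Valid C b) λ V′ → edge V′ α ≡ edge V β × edge V′ β ≡ edge V α
  exchange {C} {b} V α β same = V′ , atα , atβ
    where
    e : Fin (suc n) → ℕ
    e = edge V ∘ transpose α β

    e-inj : ∀ {c d} → e c ≡ e d → c ≡ d
    e-inj {c} {d} eq = trans (sym (transpose-inverse β α))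
      (trans (cong (transpose β α) (inj V eq)) (transpose-inverse β α))

    atα : e α ≡ edge V β
    atα with α Finₚ.≟ α
    ... | yes _  = refl
    ... | no α≢α = ⊥-elim (α≢α refl)

    atβ : e β ≡ edge V α
    atβ with β Finₚ.≟ α
    ... | yes refl = refl
    ... | no _ with β Finₚ.≟ β
    ...   | yes _  = refl
    ...   | no β≢β = ⊥-elim (β≢β refl)

    loc : ∀ c → Located b (lookup C c) (e c)
    loc c with c Finₚ.≟ α
    ... | yes refl = subst (λ s → Located b s (edge V β)) (sym same) (located V β)
    ... | no _ with c Finₚ.≟ β
    ...   | yes refl = subst (λ s → Located b s (edge V α)) same (located V α)
    ...   | no _     = located V c

    V′ : Valid C b
    V′ = record { edge = e ; inj = e-inj ; edge≤n = λ c → edge≤n V _ ; start = start V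
                ; end = end V ; located = loc }

  -- Two chips at i lie on the edges at either side; which of them lies on which
  -- edge is a matter of choice.
  normalise : ∀ {C b i} (V : Valid C b) {α β : Fin (suc n)} → α ≢ β → lookup C α ≡ i → lookup C β ≡ i →
              Σ (Valid C b) λ V′ → suc (edge V′ α) ≡ i × edge V′ β ≡ i
  normalise V {α} {β} α≢β refl eq with located V α | located V β
  ... | inj₁ (a , _) | inj₁ (b , _) = ⊥-elim (α≢β (inj V (trans (sym a) (trans (sym eq) b))))
  ... | inj₂ (a , _) | inj₂ (b , _) = ⊥-elim (α≢β (inj V (suc-injective (trans (sym a) (trans (sym eq) b)))))
  ... | inj₂ (a , _) | inj₁ (b , _) = V , sym a , trans (sym b) eq
  ... | inj₁ (a , _) | inj₂ (b , _) with exchange V α β (sym eq)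
  ...   | V′ , eα , eβ = V′ , trans (cong suc eα) (trans (sym b) eq) , trans eβ (sym a)

  -- Toppling leaves every chip on its edge: the level edge of `α` turns up, the up edge of `β`
  -- turns level, and `b` changes only at `i`.
  module Fire {C b} (V : Valid C b) {i} {α β : Fin (suc n)} (α<β : α Fin.< β)
              (αi : lookup C α ≡ i) (βi : lookup C β ≡ i)
              (eα : suc (edge V α) ≡ i) (eβ : edge V β ≡ i) where

    b′ : ℕ → ℕ
    b′ = bump i b

    C′ : Config n
    C′ = (C Vec.[ α ]≔ (i ∸ 1)) Vec.[ β ]≔ suc i

    α≢β : α ≢ β
    α≢β = Finₚ.<⇒≢ α<β

    lookup-β : lookup C′ β ≡ suc i
    lookup-β = Vecₚ.lookup∘update β (C Vec.[ α ]≔ (i ∸ 1)) (suc i)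

    lookup-α : lookup C′ α ≡ edge V α
    lookup-α = trans (Vecₚ.lookup∘update′ α≢β (C Vec.[ α ]≔ (i ∸ 1)) (suc i))
      (trans (Vecₚ.lookup∘update α C (i ∸ 1)) (cong (_∸ 1) (sym eα)))

    lookup-other : ∀ {c} → c ≢ α → c ≢ β → lookup C′ c ≡ lookup C c
    lookup-other c≢α c≢β = trans (Vecₚ.lookup∘update′ c≢β (C Vec.[ α ]≔ (i ∸ 1)) (suc i))
      (Vecₚ.lookup∘update′ c≢α C (i ∸ 1))

    downα : b i ≡ b (edge V α)
    downα with located V α
    ... | inj₁ (s , _) = ⊥-elim (1+n≢n (trans eα (trans (sym αi) s)))
    ... | inj₂ (_ , d) = trans (cong b (sym eα)) d

    upβ : b (suc i) ≡ suc (b i)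
    upβ with located V β
    ... | inj₁ (_ , u) = subst (λ e → b (suc e) ≡ suc (b e)) eβ u
    ... | inj₂ (s , _) = ⊥-elim (1+n≢n (trans (cong suc (sym eβ)) (trans (sym s) βi)))

    edgeα≢ : edge V α ≢ i
    edgeα≢ eq = 1+n≢n (trans eα (sym eq))

    b′-α : b′ (edge V α) ≡ b i
    b′-α = trans (bump-≢ b edgeα≢) (sym downα)

    b′-β : b′ (suc i) ≡ suc (b i)
    b′-β = trans (bump-≢ b 1+n≢n) upβ

    edge≢ : ∀ {c} → c ≢ β → edge V c ≢ i
    edge≢ c≢β eq = c≢β (inj V (trans eq (sym eβ)))

    1+edge≢ : ∀ {c} → c ≢ α → suc (edge V c) ≢ i
    1+edge≢ c≢α eq = c≢α (inj V (suc-injective (trans eq (sym eα))))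

    -- Chips at `i` can only lie on the edges `i - 1` and `i`, which belong to `α` and `β`. So no
    -- site ever holds three chips.
    site≢ : ∀ {c} → c ≢ α → c ≢ β → lookup C c ≢ i
    site≢ {c} c≢α c≢β eq with located V c
    ... | inj₁ (s , _) = edge≢ c≢β (trans (sym s) eq)
    ... | inj₂ (s , _) = 1+edge≢ c≢α (trans (sym s) eq)

    located′ : ∀ c → Located b′ (lookup C′ c) (edge V c)
    located′ c with c Finₚ.≟ α
    ... | yes refl = inj₁ (lookup-α , trans (cong b′ eα) (trans (bump-≡ i b) (cong suc (sym b′-α))))
    ... | no c≢α with c Finₚ.≟ β
    ...   | yes refl = inj₂ (trans lookup-β (cong suc (sym eβ)) ,
                             trans (cong (b′ ∘ suc) eβ)
                               (trans b′-β (trans (sym (bump-≡ i b)) (cong b′ (sym eβ)))))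
    ...   | no c≢β = Sum.map
      (λ (s , u) → trans (lookup-other c≢α c≢β) s ,
                   trans (bump-≢ b (1+edge≢ c≢α)) (trans u (cong suc (sym (bump-≢ b (edge≢ c≢β))))))
      (λ (s , d) → trans (lookup-other c≢α c≢β) s ,
                   trans (bump-≢ b (1+edge≢ c≢α)) (trans d (sym (bump-≢ b (edge≢ c≢β)))))
      (located V c)

    i≤n : i ≤ n
    i≤n = subst (_≤ n) eβ (edge≤n V β)

    valid′ : Valid C′ b′
    valid′ = record
      { edge = edge V ; inj = inj V ; edge≤n = edge≤n V ; located = located′
      ; start = trans (bump-≢ b (λ 0≡i → 1+n≢0 (trans eα (sym 0≡i)))) (start V)
      ; end = trans (bump-≢ b (λ eq → <-irrefl (sym eq) (s≤s i≤n))) (end V) }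

    -- For each of the two moving chips one bound tightens by one and the other survives. The
    -- tightened bound follows from that of the partner and `α < β`.
    balanced⇒ : Balanced C b → Balanced C′ b′
    balanced⇒ J c with c Finₚ.≟ α
    ... | yes refl rewrite lookup-α | b′-α =
      subst (λ s → b s ≤ toℕ α) αi (proj₁ (J α)) ,
      s≤s⁻¹ (begin
        suc (toℕ α + p + b i) ≡⟨⟩
        suc (toℕ α) + p + b i ≤⟨ +-monoˡ-≤ (b i) (+-monoˡ-≤ p α<β) ⟩
        toℕ β + p + b i       ≤⟨ subst (λ s → toℕ β + p + b s ≤ n + s) βi (proj₂ (J β)) ⟩
        n + i                 ≡⟨ cong (n +_) (sym eα) ⟩
        n + suc (edge V α)    ≡⟨ +-suc n (edge V α) ⟩
        suc (n + edge V α)    ∎)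
      where open ≤-Reasoning
    ... | no c≢α with c Finₚ.≟ β
    ...   | yes refl rewrite lookup-β | b′-β =
      ≤-<-trans (subst (λ s → b s ≤ toℕ α) αi (proj₁ (J α))) α<β ,
      subst₂ _≤_ (sym (+-suc (toℕ β + p) (b i))) (sym (+-suc n i))
        (s≤s (subst (λ s → toℕ β + p + b s ≤ n + s) βi (proj₂ (J β))))
    ...   | no c≢β rewrite lookup-other c≢α c≢β | bump-≢ b (site≢ c≢α c≢β) = J c

    -- Read backwards, the bounds of the moving chips relax, stay the same, or shift by one on both
    -- sides.
    balanced⇐ : Balanced C′ b′ → Balanced C b
    balanced⇐ J c with c Finₚ.≟ α
    ... | yes refl rewrite αi =
      subst (_≤ toℕ α) (trans (cong b′ lookup-α) b′-α) (proj₁ (J α)) ,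
      ≤-trans (subst₂ (λ x y → toℕ α + p + x ≤ n + y) (trans (cong b′ lookup-α) b′-α) lookup-α (proj₂ (J α)))
              (+-monoʳ-≤ n (≤-trans (n≤1+n _) (≤-reflexive eα)))
    ... | no c≢α with c Finₚ.≟ β
    ...   | yes refl rewrite βi =
      ≤-trans (n≤1+n _) (subst (_≤ toℕ β) (trans (cong b′ lookup-β) b′-β) (proj₁ (J β))) ,
      s≤s⁻¹ (subst₂ _≤_ (+-suc (toℕ β + p) (b i)) (+-suc n i)
        (subst₂ (λ x y → toℕ β + p + x ≤ n + y) (trans (cong b′ lookup-β) b′-β) lookup-β (proj₂ (J β))))
    ...   | no c≢β with Jc ← J c rewrite lookup-other c≢α c≢β | bump-≢ b (site≢ c≢α c≢β) = Jc

  fire : ∀ {C C′ b} → Valid C b → Topple C C′ →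
         ∃[ b′ ] (Valid C′ b′ × (Balanced C b ⇔ Balanced C′ b′) × total b′ (suc n) ≡ suc (total b (suc n)))
  fire {b = b} V (topple C i α β 1≤i i≤n α<β αi βi) with normalise V (Finₚ.<⇒≢ α<β) αi βi
  ... | V′ , eα , eβ = bump i b , valid′ , mk⇔ balanced⇒ balanced⇐ , total-bump b (s≤s i≤n)
    where open Fire V′ α<β αi βi eα eβ hiding (i≤n)

  stable? : (C : Config n) → Stable C ⊎ ∃₂ λ α β → α Fin.< β × lookup C α ≡ lookup C β
  stable? C with Finₚ.any? (λ α → Finₚ.any? (λ β → (α Finₚ.<? β) ×-dec (lookup C α ≟ lookup C β)))
  ... | yes clash = inj₂ clash
  ... | no none = inj₁ stable
    where
    stable : Stable C
    stable α β α≢β eq with Finₚ.<-cmp α β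
    ... | tri< α<β _ _ = none (α , β , α<β , eq)
    ... | tri≈ _ α≡β _ = α≢β α≡β
    ... | tri> _ _ β<α = none (β , α , β<α , sym eq)

  stabilise : ∀ {C b} → Valid C b →
              ∃[ F ] (Star Topple C F × Stable F × ∃[ b′ ] (Valid F b′ × (Balanced C b → Balanced F b′)))
  stabilise {b = b} V₀ = go (total id (suc n)) V₀ (m≤n+m (total id (suc n)) (total b (suc n)))
    where
    -- The fuel `k` covers the gap between the potential and its upper limit `total id (suc n)`.
    go : ∀ k {C b} → Valid C b → total id (suc n) ≤ total b (suc n) + k →
         ∃[ F ] (Star Topple C F × Stable F × ∃[ b′ ] (Valid F b′ × (Balanced C b → Balanced F b′)))
    go k {C} {b} V le with stable? C
    ... | inj₁ stable = C , ε , stable , b , V , id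
    ... | inj₂ (α , β , α<β , same) with normalise V (Finₚ.<⇒≢ α<β) same refl
    ... | V′ , eα , eβ with t ← topple C (lookup C β) α β (≤-trans (s≤s z≤n) (≤-reflexive eα))
                                  (subst (_≤ n) eβ (edge≤n V′ β)) α<β same refl
        with fire V t
    ... | b₁ , V₁ , iff , grow with k
    -- With no fuel left, the new path would exceed the limit, contrary to `b s ≤ s`.
    ... | zero = ⊥-elim (<-irrefl refl (≤-trans
      (≤-trans (s≤s le) (≤-reflexive (trans (cong suc (+-identityʳ _)) (sym grow))))
      (total-mono (suc n) (λ s<1+n → b≤ V₁ (<⇒≤ s<1+n)))))
    ... | suc k with go k V₁ (≤-trans le (≤-reflexive (trans (+-suc _ k) (cong (_+ k) (sym grow)))))
    ... | F , path , stable , b′ , V″ , J = F , t ◅ path , stable , b′ , V″ , J ∘ Equivalence.to iff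

  -- Stable configurations

  module Final {C b} (V : Valid C b) (stable : Stable C) where

    Up Down : ℕ → Set
    Up s = b (suc s) ≡ suc (b s)
    Down s = b (suc s) ≡ b s

    -- Two chips would meet at site s + 1, so b first climbs and then stays level.
    no-valley : ∀ {s} → suc s ≤ n → Down s → ¬ Up (suc s)
    no-valley {s} s<n down up with occupied V (<⇒≤ s<n) | occupied V s<n
    ... | c , ec | d , ed = stable c d c≢d (trans site-c (sym site-d))
      where
      c≢d : c ≢ d
      c≢d refl = 1+n≢n (trans (sym ed) ec)
      site-c : lookup C c ≡ suc s
      site-c with located V c
      ... | inj₁ (_ , u) = ⊥-elim (1+n≢n (trans (sym (subst Up ec u)) down))
      ... | inj₂ (eq , _) = trans eq (cong suc ec)
      site-d : lookup C d ≡ suc s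
      site-d with located V d
      ... | inj₁ (eq , _) = trans eq ed
      ... | inj₂ (_ , dn) = ⊥-elim (1+n≢n (trans (sym up) (subst Down ed dn)))

    -- No level step can come just before an up step, so all steps before this one go up.
    up-value : ∀ {s} → s ≤ n → Up s → b s ≡ s
    up-value {zero}  _   _  = start V
    up-value {suc s} s<n up with step V (<⇒≤ s<n)
    ... | inj₁ up′  = trans up′ (cong suc (up-value (<⇒≤ s<n) up′))
    ... | inj₂ down = ⊥-elim (no-valley s<n down up)

    b≤1+r : ∀ {s} → s ≤ suc n → b s ≤ suc r
    b≤1+r = descend (λ s → b s ≤ suc r) below
      where
      below : ∀ {s} → s ≤ suc n → (∀ {t} → s < t → t ≤ suc n → b t ≤ suc r) → b s ≤ suc r
      below s≤1+n rec with m≤n⇒m<n∨m≡n s≤1+n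
      ... | inj₂ refl = ≤-reflexive (end V)
      ... | inj₁ s<1+n with step V (s≤s⁻¹ s<1+n)
      ...   | inj₁ up   = ≤-trans (n≤1+n _) (≤-trans (≤-reflexive (sym up)) (rec ≤-refl s<1+n))
      ...   | inj₂ down = ≤-trans (≤-reflexive (sym down)) (rec ≤-refl s<1+n)

    up-bound : ∀ {s} → s ≤ n → Up s → s ≤ r
    up-bound s≤n up = s≤s⁻¹ (subst (_≤ suc r) (trans up (cong suc (up-value s≤n up))) (b≤1+r (s≤s s≤n)))

    -- After a level step all later steps are level, so `b` already has its final value.
    down-value : ∀ {s} → s ≤ n → Down s → b s ≡ suc r
    down-value = descend (λ s → Down s → b s ≡ suc r) λ s≤n rec down →
      [ (λ s<n → [ (λ up → ⊥-elim (no-valley s<n down up))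
                 , (λ down′ → trans (sym down) (rec ≤-refl s<n down′)) ]′ (step V s<n))
      , (λ { refl → trans (sym down) (end V) }) ]′ (m≤n⇒m<n∨m≡n s≤n)

    down-bound : ∀ {s} → s ≤ n → Down s → r < s
    down-bound s≤n down = subst (_≤ _) (down-value s≤n down) (b≤ V (m≤n⇒m≤1+n s≤n))

    -- The path climbs on the edges `0` to `r` and is level afterwards, so `r + 1` is the empty
    -- site.
    data Position (c : Fin (suc n)) : Set where
      low  : lookup C c ≡ edge V c → edge V c ≤ r → b (lookup C c) ≡ edge V c → Position c
      high : lookup C c ≡ suc (edge V c) → r < edge V c → b (lookup C c) ≡ suc r → Position c

    position : ∀ c → Position c
    position c with located V c
    ... | inj₁ (s , up)   = low s (up-bound (edge≤n V c) up)
      (trans (cong b s) (up-value (edge≤n V c) up))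
    ... | inj₂ (s , down) = high s (down-bound (edge≤n V c) down)
      (trans (cong b s) (trans down (down-value (edge≤n V c) down)))

    -- The condition `edge V c ≡ toℕ c` mediates between sorting and balance: each is shown
    -- equivalent to it.
    aligned⇒sorted : (∀ c → edge V c ≡ toℕ c) → Sorted C
    aligned⇒sorted eq α β α<β with position α | position β
    ... | low s _ _  | low s′ _ _  = subst₂ _<_ (sym (trans s (eq α))) (sym (trans s′ (eq β))) α<β
    ... | low s _ _  | high s′ _ _ = subst₂ _<_ (sym (trans s (eq α))) (sym (trans s′ (cong suc (eq β)))) (m<n⇒m<1+n α<β)
    ... | high s _ _ | high s′ _ _ = subst₂ _<_ (sym (trans s (cong suc (eq α)))) (sym (trans s′ (cong suc (eq β)))) (s<s α<β)
    ... | high _ h _ | low _ l _   = ⊥-elim (<-asym (subst₂ _<_ (eq β) (eq α) (≤-<-trans l h)) α<β)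

    aligned⇒balanced : (∀ c → edge V c ≡ toℕ c) → Balanced C b
    aligned⇒balanced eq c with position c
    ... | low s l bs rewrite bs | s | eq c =
      ≤-refl , +-monoˡ-≤ (toℕ c) (+-monoˡ-≤ p l)
    ... | high s h bs rewrite bs | s | eq c = h , ≤-reflexive (begin
      toℕ c + p + suc r   ≡⟨ +-assoc (toℕ c) p (suc r) ⟩
      toℕ c + (p + suc r) ≡⟨ cong (toℕ c +_) (trans (+-suc p r) (cong suc (+-comm p r))) ⟩
      toℕ c + suc n       ≡⟨ +-comm (toℕ c) (suc n) ⟩
      suc n + toℕ c       ≡⟨ sym (+-suc n (toℕ c)) ⟩
      n + suc (toℕ c)     ∎)
      where open ≡-Reasoning

    sorted⇒mono : Sorted C → ∀ {α β} → α Fin.< β → edge V α < edge V β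
    sorted⇒mono sorted {α} {β} α<β with sorted α β α<β | position α | position β
    ... | lt | low s _ _  | low s′ _ _  = subst₂ _<_ s s′ lt
    ... | lt | low _ l _  | high _ h _  = ≤-<-trans l h
    ... | lt | high s _ _ | high s′ _ _ = s<s⁻¹ (subst₂ _<_ s s′ lt)
    ... | lt | high s _ _ | low s′ _ _  = <-trans (n<1+n _) (subst₂ _<_ s s′ lt)

    -- A strictly increasing map of `0,…,n` to itself is the identity: the lower bound comes from
    -- upward induction, the upper bound from downward induction.
    sorted⇒aligned : Sorted C → ∀ c → edge V c ≡ toℕ c
    sorted⇒aligned sorted c = ≤-antisym
      (subst (λ d → edge V d ≤ toℕ d) (Finₚ.fromℕ<-toℕ c (s≤s (s≤s⁻¹ (Finₚ.toℕ<n c))))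
        (upper (toℕ c) (s≤s⁻¹ (Finₚ.toℕ<n c))))
      (subst (λ d → toℕ d ≤ edge V d) (Finₚ.fromℕ<-toℕ c (s≤s (s≤s⁻¹ (Finₚ.toℕ<n c))))
        (lower (toℕ c) (s≤s⁻¹ (Finₚ.toℕ<n c))))
      where
      chip : ∀ {s} → s ≤ n → Fin (suc n)
      chip s≤n = fromℕ< (s≤s s≤n)
      next : ∀ {s} (s<n : s < n) → chip (<⇒≤ s<n) Fin.< chip s<n
      next s<n = subst₂ _<_ (sym (Finₚ.toℕ-fromℕ< (s≤s (<⇒≤ s<n)))) (sym (Finₚ.toℕ-fromℕ< (s≤s s<n))) ≤-refl
      lower : ∀ s (s≤n : s ≤ n) → toℕ (chip s≤n) ≤ edge V (chip s≤n)
      lower zero    s≤n = subst (_≤ edge V (chip s≤n)) (sym (Finₚ.toℕ-fromℕ< (s≤s s≤n))) z≤n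
      lower (suc s) s<n = subst (_≤ edge V (chip s<n)) (sym (Finₚ.toℕ-fromℕ< (s≤s s<n)))
        (≤-<-trans (subst (_≤ edge V (chip (<⇒≤ s<n))) (Finₚ.toℕ-fromℕ< (s≤s (<⇒≤ s<n))) (lower s (<⇒≤ s<n)))
          (sorted⇒mono sorted (next s<n)))
      upper : ∀ s (s≤n : s ≤ n) → edge V (chip s≤n) ≤ toℕ (chip s≤n)
      upper s s≤n = descend (λ s → ∀ (s≤n : s ≤ n) → edge V (chip s≤n) ≤ toℕ (chip s≤n)) below s≤n s≤n
        where
        below : ∀ {s} → s ≤ n → (∀ {t} → s < t → t ≤ n → ∀ (t≤n : t ≤ n) → edge V (chip t≤n) ≤ toℕ (chip t≤n)) →
                ∀ (s≤n : s ≤ n) → edge V (chip s≤n) ≤ toℕ (chip s≤n)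
        below {s} _ rec s≤n with m≤n⇒m<n∨m≡n s≤n
        ... | inj₂ refl = subst (edge V (chip s≤n) ≤_) (sym (Finₚ.toℕ-fromℕ< (s≤s s≤n))) (edge≤n V (chip s≤n))
        ... | inj₁ s<n = s≤s⁻¹ (≤-trans (sorted⇒mono sorted (next s<n))
          (subst (edge V (chip s<n) ≤_) (trans (Finₚ.toℕ-fromℕ< (s≤s s<n)) (cong suc (sym (Finₚ.toℕ-fromℕ< (s≤s s≤n)))))
            (rec ≤-refl s<n s<n)))

    -- At a chip the height is its edge or `suc r`, according to its position, which turns the two
    -- inequalities into comparisons of the chip with its edge and with `r`.
    balanced⇒ordered : Balanced C b → ∀ c → (edge V c ≤ toℕ c × toℕ c ≤ r) ⊎ (r < toℕ c × toℕ c ≤ edge V c)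
    balanced⇒ordered J c with J c | position c
    ... | l , u | low s _ bs rewrite bs | s =
      inj₁ (l , +-cancelʳ-≤ p _ _ (+-cancelʳ-≤ (edge V c) _ _ u))
    ... | l , u | high s _ bs rewrite bs | s = inj₂ (l , +-cancelʳ-≤ (suc n) _ _ (begin
      toℕ c + suc n       ≡⟨ cong (toℕ c +_) (sym (trans (+-suc p r) (cong suc (+-comm p r)))) ⟩
      toℕ c + (p + suc r) ≡⟨ sym (+-assoc (toℕ c) p (suc r)) ⟩
      toℕ c + p + suc r   ≤⟨ u ⟩
      n + suc (edge V c)  ≡⟨ +-suc n (edge V c) ⟩
      suc n + edge V c    ≡⟨ +-comm (suc n) (edge V c) ⟩
      edge V c + suc n    ∎))
      where open ≤-Reasoning

    -- Edges do not exceed the chip up to `r` and do not fall below it beyond `r`. Injectivity then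
    -- forces equality, by induction upwards in the first range and downwards in the second.
    balanced⇒aligned : Balanced C b → ∀ c → edge V c ≡ toℕ c
    balanced⇒aligned J c with balanced⇒ordered J c
    ... | inj₁ (_ , c≤r) = lows (suc (toℕ c)) c ≤-refl c≤r
      where
      lows : ∀ k c → toℕ c < k → toℕ c ≤ r → edge V c ≡ toℕ c
      lows (suc k) c (s≤s c≤k) c≤r with balanced⇒ordered J c
      ... | inj₂ (r<c , _) = ⊥-elim (<⇒≱ r<c c≤r)
      ... | inj₁ (e≤c , _) with m≤n⇒m<n∨m≡n e≤c
      ...   | inj₂ eq  = eq
      -- The chip `d` numbered by the edge of `c` lies on that same edge by induction, so `d` is
      -- `c`.
      ...   | inj₁ e<c = trans (sym (Finₚ.toℕ-fromℕ< _)) (cong toℕ d≡c)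
        where
        d : Fin (suc n)
        d = fromℕ< (s≤s (edge≤n V c))
        d≡e : toℕ d ≡ edge V c
        d≡e = Finₚ.toℕ-fromℕ< _
        d≡c : d ≡ c
        d≡c = inj V (trans (lows k d (subst (_< k) (sym d≡e) (<-≤-trans e<c c≤k))
          (subst (_≤ r) (sym d≡e) (≤-trans e≤c c≤r))) d≡e)
    ... | inj₂ (r<c , _) = highs c r<c
      where
      highs : ∀ c → r < toℕ c → edge V c ≡ toℕ c
      highs c = descend {n} (λ s → ∀ c → toℕ c ≡ s → r < toℕ c → edge V c ≡ toℕ c) below
                  (s≤s⁻¹ (Finₚ.toℕ<n c)) c refl
        where
        below : ∀ {s} → s ≤ n →
                (∀ {t} → s < t → t ≤ n → ∀ c → toℕ c ≡ t → r < toℕ c → edge V c ≡ toℕ c) →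
                ∀ c → toℕ c ≡ s → r < toℕ c → edge V c ≡ toℕ c
        below _ rec c refl r<c with balanced⇒ordered J c
        ... | inj₁ (_ , c≤r) = ⊥-elim (<⇒≱ r<c c≤r)
        ... | inj₂ (_ , c≤e) with m≤n⇒m<n∨m≡n c≤e
        ...   | inj₂ eq  = sym eq
        ...   | inj₁ c<e = trans (sym (Finₚ.toℕ-fromℕ< _)) (cong toℕ d≡c)
          where
          d : Fin (suc n)
          d = fromℕ< (s≤s (edge≤n V c))
          d≡e : toℕ d ≡ edge V c
          d≡e = Finₚ.toℕ-fromℕ< _
          d≡c : d ≡ c
          d≡c = inj V (trans (rec c<e (edge≤n V c) d d≡e (subst (r <_) (sym d≡e) (≤-trans r<c c≤e))) d≡e)

    sorted⇔balanced : Sorted C ⇔ Balanced C b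
    sorted⇔balanced = mk⇔ (aligned⇒balanced ∘ sorted⇒aligned) (aligned⇒sorted ∘ balanced⇒aligned)

  -- Balance is carried backwards along the given run, and forwards along a run built by
  -- `stabilise`; outcomes of different runs are never compared.
  toppleable⇔balanced : ∀ {C b} → Valid C b → Toppleable n C ⇔ Balanced C b
  toppleable⇔balanced {C} {b} V = mk⇔ (λ (F , path , stable , sorted) → back V path stable sorted) forth
    where
    back : ∀ {C F b} → Valid C b → Star Topple C F → Stable F → Sorted F → Balanced C b
    back V ε stable sorted = Equivalence.to (Final.sorted⇔balanced V stable) sorted
    back V (t ◅ path) stable sorted with fire V t
    ... | b′ , V′ , iff , _ = Equivalence.from iff (back V′ path stable sorted)

    forth : Balanced C b → Toppleable n C
    forth J with stabilise V
    ... | F , path , stable , b′ , V′ , J′ =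
      F , path , stable , Equivalence.from (Final.sorted⇔balanced V′ stable) (J′ J)

-- Counting the chips at a site

lookup-extensional : ∀ {A : Set} {k} {u v : Vec A k} → (∀ i → lookup u i ≡ lookup v i) → u ≡ v
lookup-extensional {u = u} {v} eq =
  trans (sym (Vecₚ.tabulate∘lookup u)) (trans (Vecₚ.tabulate-cong eq) (Vecₚ.tabulate∘lookup v))

-- Links the list count in `chipsAt` to an enumeration of the chips themselves.
enum-chips : ∀ {k} (C : Vec ℕ k) s →
             Enum (λ c → lookup C c ≡ s) (length (filter (λ x → x ≟ s) (Vec.toList C)))
enum-chips [] s = enum-resp (λ ()) (λ { {()} }) enum-⊥
enum-chips (x ∷ C) s with x ≟ s | enum-map suc (λ _ _ → Finₚ.suc-injective) (enum-chips C s)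
... | yes x≡s | E = subst (λ xs → Enum (λ c → lookup (x ∷ C) c ≡ s) (length xs)) (sym (filter-accept (_≟ s) x≡s)) (enum-resp
  (λ { (inj₁ refl) → x≡s ; (inj₂ (_ , eq , refl)) → eq })
  (λ { {zero} _ → inj₁ refl ; {suc c} eq → inj₂ (c , eq , refl) })
  (enum-insert zero (λ { (_ , _ , ()) }) E))
... | no x≢s | E = subst (λ xs → Enum (λ c → lookup (x ∷ C) c ≡ s) (length xs)) (sym (filter-reject (_≟ s) x≢s)) (enum-resp
  (λ { (_ , eq , refl) → eq })
  (λ { {zero} eq → ⊥-elim (x≢s eq) ; {suc c} eq → c , eq , refl }) E)

enum-one : ∀ {A : Set} {P : A → Set} → Enum P 1 → ∀ {x y} → P x → P y → x ≡ y
enum-one (enum (a ∷ []) _ _ c _) Px Py with c Px | c Py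
... | here refl | here refl = refl

enum-two : ∀ {k} {P : Fin k → Set} → Enum P 2 →
           ∃₂ λ α β → α Fin.< β × P α × P β × (∀ {c} → P c → c ≡ α ⊎ c ≡ β)
enum-two {P = P} (enum (a ∷ b ∷ []) ((a≢b ∷ _) ∷ _) s c _) with Finₚ.<-cmp a b
... | tri< a<b _ _ = a , b , a<b , s (here refl) , s (there (here refl)) , λ Pc → cases (c Pc)
  where
  cases : ∀ {c} → c ∈ a ∷ b ∷ [] → c ≡ a ⊎ c ≡ b
  cases (here eq)         = inj₁ eq
  cases (there (here eq)) = inj₂ eq
... | tri≈ _ a≡b _ = ⊥-elim (a≢b a≡b)
... | tri> _ _ b<a = b , a , b<a , s (there (here refl)) , s (here refl) , λ Pc → cases (c Pc)
  where
  cases : ∀ {c} → c ∈ a ∷ b ∷ [] → c ≡ b ⊎ c ≡ a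
  cases (here eq)         = inj₂ eq
  cases (there (here eq)) = inj₁ eq

occupancy-≡ : ∀ p → occupancy p p ≡ 2
occupancy-≡ p with p ≟ p
... | yes _  = refl
... | no p≢p = ⊥-elim (p≢p refl)

occupancy-≢ : ∀ {p s} → s ≢ p → occupancy p s ≡ 1
occupancy-≢ {p} {s} s≢p with s ≟ p
... | yes eq = ⊥-elim (s≢p eq)
... | no _   = refl

-- Slots and configurations

slot≟ : (s s′ : Slot) → Dec (s ≡ s′)
slot≟ = Sumₚ.≡-dec _≟_ _≟_

swap₀ : Slot → Slot
swap₀ (inj₁ zero) = inj₂ zero
swap₀ (inj₂ zero) = inj₁ zero
swap₀ s           = s

swap₀-involutive : ∀ s → swap₀ (swap₀ s) ≡ s
swap₀-involutive (inj₁ zero)    = refl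
swap₀-involutive (inj₁ (suc _)) = refl
swap₀-involutive (inj₂ zero)    = refl
swap₀-involutive (inj₂ (suc _)) = refl

swap₀-injective : ∀ {s s′} → swap₀ s ≡ swap₀ s′ → s ≡ s′
swap₀-injective {s} {s′} eq =
  trans (sym (swap₀-involutive s)) (trans (cong swap₀ eq) (swap₀-involutive s′))

module Slots (r p : ℕ) (1≤p : 1 ≤ p) where

  open Dynamics r p

  -- From here on inj₁ is always the left side and inj₂ the right side.
  site : Slot → ℕ
  site (inj₁ y) = p ∸ y
  site (inj₂ x) = p + x

  -- The initial path `s ∸ p` is level on the edges below `p`, whose chips stand at the end nearer
  -- to `p`, and climbs from `p` on.
  edgeOf : Slot → ℕ
  edgeOf (inj₁ y) = p ∸ suc y
  edgeOf (inj₂ x) = p + x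

  InRange : Slot → Set
  InRange (inj₁ y) = y < p
  InRange (inj₂ x) = x ≤ r

  Allowed : ℕ → Slot → Set
  Allowed c (inj₁ y) = y + c ≤ n
  Allowed c (inj₂ x) = x ≤ c

  record Placement (E : Vec Slot (suc n)) : Set where
    constructor placement
    field
      injective : InjectiveVec E
      inRange   : ∀ c → InRange (lookup E c)

  open Placement

  AllAllowed : Vec Slot (suc n) → Set
  AllAllowed E = ∀ c → Allowed (toℕ c) (lookup E c)

  Admissible : Vec Slot (suc n) → Set
  Admissible E = Placement E × AllAllowed E

  p+≤n : ∀ {x} → x ≤ r → p + x ≤ n
  p+≤n {x} x≤r = ≤-trans (+-monoʳ-≤ p x≤r) (≤-reflexive (+-comm p r))

  p≤n : p ≤ n
  p≤n = m≤n+m p r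

  edgeOf-left : ∀ {y x} → y < p → p ∸ suc y ≢ p + x
  edgeOf-left {y} {x} y<p eq = <-irrefl refl (begin-strict
    p ∸ suc y <⟨ ∸-monoʳ-< (s≤s (z≤n {y})) y<p ⟩
    p         ≤⟨ m≤m+n p x ⟩
    p + x     ≡⟨ sym eq ⟩
    p ∸ suc y ∎)
    where open ≤-Reasoning

  edgeOf-injective : ∀ {s s′} → InRange s → InRange s′ → edgeOf s ≡ edgeOf s′ → s ≡ s′
  edgeOf-injective {inj₁ y} {inj₁ y′} a b eq = cong inj₁ (suc-injective (∸-cancelˡ-≡ a b eq))
  edgeOf-injective {inj₁ y} {inj₂ x}  a b eq = ⊥-elim (edgeOf-left a eq)
  edgeOf-injective {inj₂ x} {inj₁ y}  a b eq = ⊥-elim (edgeOf-left b (sym eq))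
  edgeOf-injective {inj₂ x} {inj₂ x′} a b eq = cong inj₂ (+-cancelˡ-≡ p _ _ eq)

  edgeOf≤n : ∀ {s} → InRange s → edgeOf s ≤ n
  edgeOf≤n {inj₁ y} _   = ≤-trans (m∸n≤m p (suc y)) p≤n
  edgeOf≤n {inj₂ x} x≤r = p+≤n x≤r

  site-left : ∀ {y} → y < p → p ∸ y ≡ suc (p ∸ suc y)
  site-left y<p = +-∸-assoc 1 y<p

  site-range : ∀ {s} → InRange s → 1 ≤ site s × site s ≤ n
  site-range {inj₁ y} y<p = m<n⇒0<n∸m y<p , ≤-trans (m∸n≤m p y) p≤n
  site-range {inj₂ x} x≤r = ≤-trans 1≤p (m≤m+n p x) , p+≤n x≤r

  site-left-right : ∀ {y x} → y < p → p ∸ y ≡ p + x → y ≡ 0 × x ≡ 0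
  site-left-right {zero} {x} _ eq = refl , +-cancelˡ-≡ p _ _ (trans (sym eq) (sym (+-identityʳ p)))
  site-left-right {suc y} {x} y<p eq = ⊥-elim (edgeOf-left (<-trans (n<1+n y) y<p) eq)

  site-injective : ∀ {s s′} → InRange s → InRange s′ → site s ≡ site s′ → s′ ≡ s ⊎ s′ ≡ swap₀ s
  site-injective {inj₁ y} {inj₁ y′} a b eq = inj₁ (cong inj₁ (sym (∸-cancelˡ-≡ (<⇒≤ a) (<⇒≤ b) eq)))
  site-injective {inj₁ y} {inj₂ x}  a b eq with refl , refl ← site-left-right a eq = inj₂ refl
  site-injective {inj₂ x} {inj₁ y}  a b eq with refl , refl ← site-left-right b (sym eq) = inj₂ refl
  site-injective {inj₂ x} {inj₂ x′} a b eq = inj₁ (cong inj₂ (sym (+-cancelˡ-≡ p _ _ eq)))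

  site≡p : ∀ {s} → InRange s → site s ≡ p → s ≡ inj₁ 0 ⊎ s ≡ inj₂ 0
  site≡p a eq = site-injective {inj₁ 0} 1≤p a (sym eq)

  config : Vec Slot (suc n) → Config n
  config = Vec.map site

  lookup-config : ∀ E c → lookup (config E) c ≡ site (lookup E c)
  lookup-config E c = Vecₚ.lookup-map c site E

  located₀ : ∀ {s} → InRange s → Located (_∸ p) (site s) (edgeOf s)
  located₀ {inj₁ y} y<p = inj₂ (site-left y<p ,
    trans (cong (_∸ p) (sym (site-left y<p)))
      (trans (m≤n⇒m∸n≡0 (m∸n≤m p y)) (sym (m≤n⇒m∸n≡0 (m∸n≤m p (suc y))))))
  located₀ {inj₂ x} _ = inj₁ (refl ,
    trans (cong (_∸ p) (sym (+-suc p x))) (trans (m+n∸m≡n p (suc x)) (cong suc (sym (m+n∸m≡n p x)))))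

  initial : ∀ {E} → Placement E → Valid (config E) (_∸ p)
  initial {E} P = record
    { edge    = edgeOf ∘ lookup E
    ; inj     = injective P ∘ edgeOf-injective (inRange P _) (inRange P _)
    ; edge≤n  = λ c → edgeOf≤n (inRange P c)
    ; start   = 0∸n≡0 p
    ; end     = m+n∸n≡m (suc r) p
    ; located = λ c → subst (λ s → Located (_∸ p) s (edgeOf (lookup E c))) (sym (lookup-config E c))
                        (located₀ (inRange P c)) }

  -- In a left slot the initial height is 0 and only the second inequality restricts. In a right
  -- slot the height is `x`, and the second inequality reduces to `c ≤ n`.
  allowed⇒ : ∀ {c s} → c ≤ n → InRange s → Allowed c s →
             site s ∸ p ≤ c × c + p + (site s ∸ p) ≤ n + site s
  allowed⇒ {c} {inj₁ y} c≤n y<p y+c≤n rewrite m≤n⇒m∸n≡0 (m∸n≤m p y) = z≤n , (begin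
    c + p + 0           ≡⟨ +-identityʳ (c + p) ⟩
    c + p               ≡⟨ cong (c +_) (sym (m+[n∸m]≡n (<⇒≤ y<p))) ⟩
    c + (y + (p ∸ y))   ≡⟨ sym (+-assoc c y (p ∸ y)) ⟩
    c + y + (p ∸ y)     ≤⟨ +-monoˡ-≤ (p ∸ y) (≤-trans (≤-reflexive (+-comm c y)) y+c≤n) ⟩
    n + (p ∸ y)         ∎)
    where open ≤-Reasoning
  allowed⇒ {c} {inj₂ x} c≤n _ x≤c rewrite m+n∸m≡n p x = x≤c ,
    ≤-trans (≤-reflexive (+-assoc c p x)) (+-monoˡ-≤ (p + x) c≤n)

  allowed⇐ : ∀ {c s} → InRange s → site s ∸ p ≤ c × c + p + (site s ∸ p) ≤ n + site s → Allowed c s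
  allowed⇐ {c} {inj₁ y} y<p (_ , le) = +-cancelʳ-≤ (p ∸ y) _ _ (begin
    y + c + (p ∸ y)     ≡⟨ cong (_+ (p ∸ y)) (+-comm y c) ⟩
    c + y + (p ∸ y)     ≡⟨ +-assoc c y (p ∸ y) ⟩
    c + (y + (p ∸ y))   ≡⟨ cong (c +_) (m+[n∸m]≡n (<⇒≤ y<p)) ⟩
    c + p               ≤⟨ m≤m+n (c + p) _ ⟩
    c + p + (p ∸ y ∸ p) ≤⟨ le ⟩
    n + (p ∸ y)         ∎)
    where open ≤-Reasoning
  allowed⇐ {c} {inj₂ x} _ (le , _) = subst (_≤ c) (m+n∸m≡n p x) le

  toppleable⇔allowed : ∀ {E} → Placement E → Toppleable n (config E) ⇔ AllAllowed E
  toppleable⇔allowed {E} P = mk⇔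
    (λ t c → allowed⇐ (inRange P c)
      (subst Bal (lookup-config E c) (Equivalence.to (toppleable⇔balanced (initial P)) t c)))
    (λ allowed → Equivalence.from (toppleable⇔balanced (initial P))
      (λ c → subst Bal (sym (lookup-config E c))
        (allowed⇒ (s≤s⁻¹ (Finₚ.toℕ<n c)) (inRange P c) (allowed c))))
    where
    Bal : ∀ {c} → ℕ → Set
    Bal {c} s = s ∸ p ≤ c × c + p + (s ∸ p) ≤ n + s

  filled : ∀ {E} → Placement E → ∀ {s} → InRange s → ∃[ c ] lookup E c ≡ s
  filled P a with injective⇒surjective _ (Valid.inj (initial P)) (Valid.edge≤n (initial P)) (edgeOf≤n a)
  ... | c , eq = c , edgeOf-injective (inRange P c) a eq

  -- Exchanging the two slots at `p`

  swap₀-inRange : ∀ {s} → InRange s → InRange (swap₀ s)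
  swap₀-inRange {inj₁ zero}    _ = z≤n
  swap₀-inRange {inj₁ (suc _)} a = a
  swap₀-inRange {inj₂ zero}    _ = 1≤p
  swap₀-inRange {inj₂ (suc _)} a = a

  -- Slot 0 on either side admits every chip.
  swap₀-allowed : ∀ {c s} → c ≤ n → Allowed c s → Allowed c (swap₀ s)
  swap₀-allowed {s = inj₁ zero}    _   _ = z≤n
  swap₀-allowed {s = inj₁ (suc _)} _   a = a
  swap₀-allowed {s = inj₂ zero}    c≤n _ = c≤n
  swap₀-allowed {s = inj₂ (suc _)} _   a = a

  exchange₀ : Vec Slot (suc n) → Vec Slot (suc n)
  exchange₀ = Vec.map swap₀

  lookup-exchange₀ : ∀ E c → lookup (exchange₀ E) c ≡ swap₀ (lookup E c)
  lookup-exchange₀ E c = Vecₚ.lookup-map c swap₀ E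

  exchange₀-involutive : ∀ E → exchange₀ (exchange₀ E) ≡ E
  exchange₀-involutive E = lookup-extensional λ c → trans (lookup-exchange₀ (exchange₀ E) c)
    (trans (cong swap₀ (lookup-exchange₀ E c)) (swap₀-involutive (lookup E c)))

  exchange₀-placement : ∀ {E} → Placement E → Placement (exchange₀ E)
  exchange₀-placement {E} P = placement
    (λ {i} {j} eq → injective P (swap₀-injective
      (trans (sym (lookup-exchange₀ E i)) (trans eq (lookup-exchange₀ E j)))))
    (λ c → subst InRange (sym (lookup-exchange₀ E c)) (swap₀-inRange (inRange P c)))

  exchange₀-admissible : ∀ {E} → Admissible E → Admissible (exchange₀ E)
  exchange₀-admissible {E} (P , allowed) = exchange₀-placement P , λ c →
    subst (Allowed (toℕ c)) (sym (lookup-exchange₀ E c))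
      (swap₀-allowed (s≤s⁻¹ (Finₚ.toℕ<n c)) (allowed c))

  -- Selects one of the two placements of a configuration: the smaller chip at `p` takes the left
  -- slot.
  Ordered : Vec Slot (suc n) → Set
  Ordered E = ∃₂ λ α β → α Fin.< β × lookup E α ≡ inj₁ 0 × lookup E β ≡ inj₂ 0

  ordered? : Decidable Ordered
  ordered? E = Finₚ.any? λ α → Finₚ.any? λ β →
    (α Finₚ.<? β) ×-dec (slot≟ (lookup E α) (inj₁ 0) ×-dec slot≟ (lookup E β) (inj₂ 0))

  ordered-or-exchanged : ∀ {E} → Placement E → Ordered E ⊎ Ordered (exchange₀ E)
  ordered-or-exchanged {E} P with filled P {inj₁ 0} 1≤p | filled P {inj₂ 0} z≤n
  ... | α , eα | β , eβ with Finₚ.<-cmp α β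
  ... | tri< α<β _ _ = inj₁ (α , β , α<β , eα , eβ)
  ... | tri≈ _ refl _ = case trans (sym eα) eβ of λ ()
  ... | tri> _ _ β<α = inj₂ (β , α , β<α ,
    trans (lookup-exchange₀ E β) (cong swap₀ eβ) , trans (lookup-exchange₀ E α) (cong swap₀ eα))

  ordered-not-exchanged : ∀ {E} → Placement E → Ordered E → ¬ Ordered (exchange₀ E)
  ordered-not-exchanged {E} P (α , β , α<β , eα , eβ) (α′ , β′ , α′<β′ , eα′ , eβ′) =
    <-asym α<β (subst₂ Fin._<_ (injective P (trans (undo α′ eα′) (sym eβ)))
                               (injective P (trans (undo β′ eβ′) (sym eα))) α′<β′)
    where
    undo : ∀ c {s} → lookup (exchange₀ E) c ≡ s → lookup E c ≡ swap₀ s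
    undo c eq = trans (sym (swap₀-involutive (lookup E c)))
      (cong swap₀ (trans (sym (lookup-exchange₀ E c)) eq))

  config-site : ∀ {E E′} → config E ≡ config E′ → ∀ c → site (lookup E c) ≡ site (lookup E′ c)
  config-site {E} {E′} eq c =
    trans (sym (lookup-config E c)) (trans (cong (λ C → lookup C c) eq) (lookup-config E′ c))

  -- Otherwise the other chip at `p` would sit right in `E` and left in `E′`, hence be larger than
  -- `c` by `Ordered E` and smaller by `Ordered E′`.
  ordered-agree : ∀ {E E′} → Placement E → Placement E′ → Ordered E → Ordered E′ → config E ≡ config E′ →
                  ∀ {c} → lookup E c ≡ inj₁ 0 → lookup E′ c ≢ inj₂ 0
  ordered-agree {E} {E′} P P′ (α , β , α<β , eα , eβ) (α′ , β′ , α′<β′ , eα′ , eβ′) eq {c} ec ec′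
    with refl ← injective P (trans ec (sym eα)) | refl ← injective P′ (trans ec′ (sym eβ′))
    with site≡p (inRange P α′) (trans (config-site {E} {E′} eq α′) (cong site eα′))
  ... | inj₁ e = <-irrefl (cong toℕ (injective P (trans e (sym eα)))) α′<β′
  ... | inj₂ e = <-asym α<β (subst (Fin._< α) (injective P (trans e (sym eβ))) α′<β′)

  config-injective : ∀ {E E′} → Placement E → Placement E′ → Ordered E → Ordered E′ →
                     config E ≡ config E′ → E ≡ E′
  config-injective {E} {E′} P P′ O O′ eq = lookup-extensional agree
    where
    agree : ∀ c → lookup E c ≡ lookup E′ c
    agree c with site-injective (inRange P c) (inRange P′ c) (config-site {E} {E′} eq c)
    ... | inj₁ e = sym e
    ... | inj₂ e with lookup E c in ec | lookup E′ c in ec′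
    agree c | inj₂ refl | inj₁ zero    | _ = ⊥-elim (ordered-agree P P′ O O′ eq ec ec′)
    agree c | inj₂ refl | inj₁ (suc _) | _ = refl
    agree c | inj₂ refl | inj₂ zero    | _ = ⊥-elim (ordered-agree P′ P O′ O (sym eq) ec′ ec)
    agree c | inj₂ refl | inj₂ (suc _) | _ = refl

  -- Placements and the configurations of S(n,p)

  slotAt : ∀ {s} → 1 ≤ s → s ≤ n → ∃[ t ] (InRange t × site t ≡ s)
  slotAt {s} 1≤s s≤n with ≤-total s p
  ... | inj₁ s≤p = inj₁ (p ∸ s) , ∸-monoʳ-< 1≤s s≤p , m∸[m∸n]≡n s≤p
  ... | inj₂ p≤s = inj₂ (s ∸ p) , subst (s ∸ p ≤_) (m+n∸n≡m r p) (∸-monoˡ-≤ p s≤n) , m+[n∸m]≡n p≤s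

  placement⇒InS : ∀ {E} → Placement E → InS n p (config E)
  placement⇒InS {E} P =
    (λ c → subst (λ s → 1 ≤ s × s ≤ n) (sym (lookup-config E c)) (site-range (inRange P c))) , count
    where
    count : ∀ s → 1 ≤ s → s ≤ n → chipsAt (config E) s ≡ occupancy p s
    count s 1≤s s≤n with s ≟ p
    ... | yes refl with filled P {inj₁ 0} 1≤p | filled P {inj₂ 0} z≤n
    ...   | α , eα | β , eβ = enum-unique (enum-chips (config E) p) (enum-resp
      [ (λ { refl → at eα }) , (λ { refl → trans (at eβ) (+-identityʳ p) }) ]′
      (λ {c} eq → Sum.map (λ e → injective P (trans e (sym eα))) (λ e → injective P (trans e (sym eβ)))
        (site≡p (inRange P c) (trans (sym (lookup-config E c)) eq)))
      (enum-insert α (λ { refl → case trans (sym eα) eβ of λ () }) (enum-singleton β)))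
      where
      at : ∀ {c t} → lookup E c ≡ t → lookup (config E) c ≡ site t
      at {c} e = trans (lookup-config E c) (cong site e)
    count s 1≤s s≤n | no s≢p with slotAt 1≤s s≤n
    ... | t , a , refl with filled P a
    ... | γ , eγ = enum-unique (enum-chips (config E) s) (enum-resp
      (λ { refl → trans (lookup-config E γ) (cong site eγ) })
      (λ {c} eq → injective P (trans
        (unswapped (site-injective a (inRange P c) (sym (trans (sym (lookup-config E c)) eq)))) (sym eγ)))
      (enum-singleton γ))
      where
      unswapped : ∀ {t′} → t′ ≡ t ⊎ t′ ≡ swap₀ t → t′ ≡ t
      unswapped (inj₁ eq) = eq
      unswapped (inj₂ eq) = trans eq (fixed t s≢p)
        where
        fixed : ∀ t → site t ≢ p → swap₀ t ≡ t
        fixed (inj₁ zero)    ne = ⊥-elim (ne refl)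
        fixed (inj₁ (suc _)) ne = refl
        fixed (inj₂ zero)    ne = ⊥-elim (ne (+-identityʳ p))
        fixed (inj₂ (suc _)) ne = refl

  InS⇒placement : ∀ {C} → InS n p C → ∃[ E ] (Placement E × Ordered E × config E ≡ C)
  InS⇒placement {C} (range , count)
    with enum-two (subst (Enum _) (trans (count p 1≤p p≤n) (occupancy-≡ p)) (enum-chips C p))
  ... | α , β , α<β , atα , atβ , pair = E , placement E-injective E-range ,
    (α , β , α<β , trans (lookup-E α) slot-α , trans (lookup-E β) slot-β) ,
    lookup-extensional (λ c → trans (lookup-config E c) (trans (cong site (lookup-E c)) (site-slot c)))
    where
    slot : Fin (suc n) → Slot
    slot c with c Finₚ.≟ α | c Finₚ.≟ β
    ... | yes _ | _     = inj₁ 0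
    ... | no _  | yes _ = inj₂ 0
    ... | no _  | no _  = proj₁ (slotAt (proj₁ (range c)) (proj₂ (range c)))

    E : Vec Slot (suc n)
    E = tabulate slot

    lookup-E : ∀ c → lookup E c ≡ slot c
    lookup-E = Vecₚ.lookup∘tabulate slot

    slot-α : slot α ≡ inj₁ 0
    slot-α with α Finₚ.≟ α
    ... | yes _  = refl
    ... | no α≢α = ⊥-elim (α≢α refl)

    slot-β : slot β ≡ inj₂ 0
    slot-β with β Finₚ.≟ α | β Finₚ.≟ β
    ... | yes refl | _     = ⊥-elim (<-irrefl refl α<β)
    ... | no _  | yes _    = refl
    ... | no _  | no β≢β   = ⊥-elim (β≢β refl)

    site-slot : ∀ c → site (slot c) ≡ lookup C c
    site-slot c with c Finₚ.≟ α | c Finₚ.≟ β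
    ... | yes refl | _        = sym atα
    ... | no _     | yes refl = trans (+-identityʳ p) (sym atβ)
    ... | no _     | no _     = proj₂ (proj₂ (slotAt (proj₁ (range c)) (proj₂ (range c))))

    slot-range : ∀ c → InRange (slot c)
    slot-range c with c Finₚ.≟ α | c Finₚ.≟ β
    ... | yes _ | _     = 1≤p
    ... | no _  | yes _ = z≤n
    ... | no _  | no _  = proj₁ (proj₂ (slotAt (proj₁ (range c)) (proj₂ (range c))))

    E-range : ∀ c → InRange (lookup E c)
    E-range c = subst InRange (sym (lookup-E c)) (slot-range c)

    -- Chips with equal slots share a site. Away from `p` a site holds one chip only, and at `p` the
    -- two chips were given different slots.
    slot-injective : ∀ {c d} → slot c ≡ slot d → c ≡ d
    slot-injective {c} {d} eq with lookup C c ≟ p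
    ... | no c≢p = enum-one (subst (Enum _)
        (trans (count (lookup C c) (proj₁ (range c)) (proj₂ (range c))) (occupancy-≢ c≢p)) (enum-chips C (lookup C c)))
        refl (trans (sym (site-slot d)) (trans (cong site (sym eq)) (site-slot c)))
    ... | yes c≡p with pair c≡p
                     | pair {d} (trans (sym (site-slot d)) (trans (cong site (sym eq)) (trans (site-slot c) c≡p)))
    ...   | inj₁ refl | inj₁ refl = refl
    ...   | inj₁ refl | inj₂ refl = case trans (sym slot-α) (trans eq slot-β) of λ ()
    ...   | inj₂ refl | inj₁ refl = case trans (sym slot-β) (trans eq slot-α) of λ ()
    ...   | inj₂ refl | inj₂ refl = refl

    E-injective : InjectiveVec E
    E-injective {c} {d} eq = slot-injective (trans (sym (lookup-E c)) (trans eq (lookup-E d)))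

  -- `exchange₀` matches the ordered admissible placements with the others, and `config` matches the
  -- ordered ones with the toppleable configurations.
  enum-toppleable : ∀ {k} → Enum Admissible k →
                    ∃[ i ] (Enum (λ C → InS n p C × Toppleable n C) i × 2 * i ≡ k)
  enum-toppleable E with enum-partition ordered? E
  ... | i , j , E₁ , E₂ , i+j≡k = i , enum-resp to from E₃ ,
    trans (cong (i +_) (+-identityʳ i)) (trans (cong (i +_) (enum-unique E₁′ E₂)) i+j≡k)
    where
    E₁′ : Enum (λ E → Admissible E × ¬ Ordered E) i
    E₁′ = enum-resp
      (λ { (E , (A , O) , refl) → exchange₀-admissible A , ordered-not-exchanged (proj₁ A) O })
      (λ { {E} (A , ¬O) → exchange₀ E ,
           (exchange₀-admissible A , [ (λ O → ⊥-elim (¬O O)) , id ]′ (ordered-or-exchanged (proj₁ A))) ,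
           sym (exchange₀-involutive E) })
      (enum-map exchange₀ (λ {E} {E′} _ _ eq →
        trans (sym (exchange₀-involutive E)) (trans (cong exchange₀ eq) (exchange₀-involutive E′))) E₁)

    E₃ = enum-map config (λ ((P , _) , O) ((P′ , _) , O′) → config-injective P P′ O O′) E₁

    to : ∀ {C} → ∃[ E ] ((Admissible E × Ordered E) × C ≡ config E) → InS n p C × Toppleable n C
    to (_ , ((P , allowed) , _) , refl) =
      placement⇒InS P , Equivalence.from (toppleable⇔allowed P) allowed

    from : ∀ {C} → InS n p C × Toppleable n C → ∃[ E ] ((Admissible E × Ordered E) × C ≡ config E)
    from {C} (S , T) with InS⇒placement {C} S
    ... | E , P , O , refl = E , ((P , Equivalence.to (toppleable⇔allowed P) T) , O) , refl

  -- The own side of the chips 0,…,r is the right one, and their order is reversed so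
  -- that the staircases of both halves grow from the end of the vector.
  lowHalf : Vec Slot (suc r) → Vec Slot (suc r)
  lowHalf u = tabulate (Sum.swap ∘ lookup u ∘ opposite)

  assemble : Vec Slot (suc r) × Vec Slot p → Vec Slot (suc n)
  assemble (u , v) = lowHalf u Vec.++ v

  lowChip : Fin (suc r) → Fin (suc n)
  lowChip k = opposite k ↑ˡ p

  highChip : Fin p → Fin (suc n)
  highChip j = suc r ↑ʳ j

  toℕ-lowChip : ∀ k → toℕ (lowChip k) ≡ r ∸ toℕ k
  toℕ-lowChip k = trans (Finₚ.toℕ-↑ˡ (opposite k) p) (Finₚ.opposite-prop k)

  toℕ-highChip : ∀ j → toℕ (highChip j) ≡ suc r + toℕ j
  toℕ-highChip j = Finₚ.toℕ-↑ʳ (suc r) j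

  data ChipView : Fin (suc n) → Set where
    low  : ∀ k → ChipView (lowChip k)
    high : ∀ j → ChipView (highChip j)

  chipView : ∀ c → ChipView c
  chipView c with splitAt (suc r) c in eq
  ... | inj₁ i = subst ChipView (trans (cong (_↑ˡ p) (Finₚ.opposite-involutive i))
                                       (Finₚ.splitAt⁻¹-↑ˡ {suc r} eq)) (low (opposite i))
  ... | inj₂ j = subst ChipView (Finₚ.splitAt⁻¹-↑ʳ {suc r} eq) (high j)

  low≢high : ∀ k j → lowChip k ≢ highChip j
  low≢high k j eq = <-irrefl (trans (sym (toℕ-lowChip k)) (trans (cong toℕ eq) (toℕ-highChip j)))
    (s≤s (≤-trans (m∸n≤m r (toℕ k)) (m≤m+n r (toℕ j))))

  lowChip-injective : ∀ {k l} → lowChip k ≡ lowChip l → k ≡ l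
  lowChip-injective {k} {l} eq = trans (sym (Finₚ.opposite-involutive k))
    (trans (cong opposite (Finₚ.↑ˡ-injective p _ _ eq)) (Finₚ.opposite-involutive l))

  lookup-low : ∀ u v k → lookup (assemble (u , v)) (lowChip k) ≡ Sum.swap (lookup u k)
  lookup-low u v k = trans (Vecₚ.lookup-++ˡ (lowHalf u) v (opposite k))
    (trans (Vecₚ.lookup∘tabulate (Sum.swap ∘ lookup u ∘ opposite) (opposite k)) (cong (Sum.swap ∘ lookup u) (Finₚ.opposite-involutive k)))

  lookup-high : ∀ u v j → lookup (assemble (u , v)) (highChip j) ≡ lookup v j
  lookup-high u v j = Vecₚ.lookup-++ʳ (lowHalf u) v j

  swap-injective : ∀ {s s′ : Slot} → Sum.swap s ≡ Sum.swap s′ → s ≡ s′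
  swap-injective {inj₁ _} {inj₁ _} refl = refl
  swap-injective {inj₂ _} {inj₂ _} refl = refl

  assemble-injective : ∀ {w w′} → assemble w ≡ assemble w′ → w ≡ w′
  assemble-injective {u , v} {u′ , v′} eq = cong₂ _,_
    (lookup-extensional λ k → swap-injective
      (trans (sym (lookup-low u v k)) (trans (cong (λ E → lookup E (lowChip k)) eq) (lookup-low u′ v′ k))))
    (lookup-extensional λ j →
      trans (sym (lookup-high u v j)) (trans (cong (λ E → lookup E (highChip j)) eq) (lookup-high u′ v′ j)))

  disassemble : ∀ E → ∃[ w ] E ≡ assemble w
  disassemble E = (u , v) , lookup-extensional agree
    where
    u = tabulate (λ k → Sum.swap (lookup E (lowChip k)))
    v = tabulate (λ j → lookup E (highChip j))
    agree : ∀ c → lookup E c ≡ lookup (assemble (u , v)) c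
    agree c with chipView c
    ... | low k  = sym (trans (lookup-low u v k) (trans (cong Sum.swap (Vecₚ.lookup∘tabulate (λ k → Sum.swap (lookup E (lowChip k))) k))
                     (Sumₚ.swap-involutive (lookup E (lowChip k)))))
    ... | high j = sym (trans (lookup-high u v j) (Vecₚ.lookup∘tabulate (λ j → lookup E (highChip j)) j))

  -- Row `k` of the low half is chip `r ∸ k`, and row `j` of the high half is chip `suc r + j`. The
  -- swap is there because the own side of a low chip is the right one.
  LowGood HighGood : ℕ → Slot → Set
  LowGood k s  = InRange (Sum.swap s) × Allowed (r ∸ k) (Sum.swap s)
  HighGood j s = InRange s × Allowed (suc r + j) s

  lowGood-own : ∀ {k x} → LowGood k (inj₁ x) → k ≤ r → x + k < suc r
  lowGood-own {k} (_ , x≤) k≤r = s≤s (subst (_ ≤_) (m∸n+n≡m k≤r) (+-monoˡ-≤ k x≤))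

  own-lowGood : ∀ {k x} → x + k < suc r → LowGood k (inj₁ x)
  own-lowGood {k} {x} (s≤s le) = m+n≤o⇒m≤o x le , m+n≤o⇒m≤o∸n x le

  -- A chip up to `r` is allowed in every left slot, since `y < p` and `n` is `r + p`; only its own
  -- side restricts it.
  other-lowGood : ∀ {k y} → y < p → LowGood k (inj₂ y)
  other-lowGood {k} {y} y<p = y<p , ≤-trans (≤-reflexive (+-comm y (r ∸ k))) (+-mono-≤ (m∸n≤m r k) (<⇒≤ y<p))

  highGood-own : ∀ {j y} → HighGood j (inj₁ y) → y + j < p
  highGood-own {j} {y} (_ , le) = +-cancelˡ-≤ r _ _ (subst (_≤ n) (rotate y j) le)
    where
    rotate : ∀ y j → y + (suc r + j) ≡ r + suc (y + j)
    rotate y j = trans (+-comm y (suc r + j)) (trans (cong suc (trans (+-assoc r j y) (cong (r +_) (+-comm j y))))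
      (sym (+-suc r (y + j))))

  own-highGood : ∀ {j y} → y + j < p → HighGood j (inj₁ y)
  own-highGood {j} {y} lt = ≤-trans (s≤s (m≤m+n y j)) lt , (begin
    y + (suc r + j)  ≡⟨ +-comm y (suc r + j) ⟩
    suc (r + j + y)  ≡⟨ cong suc (+-assoc r j y) ⟩
    suc (r + (j + y)) ≡⟨ sym (+-suc r (j + y)) ⟩
    r + suc (j + y)  ≡⟨ cong (λ z → r + suc z) (+-comm j y) ⟩
    r + suc (y + j)  ≤⟨ +-monoʳ-≤ r lt ⟩
    r + p            ∎)
    where open ≤-Reasoning

  -- Chips above `r` exceed the number of every right slot.
  other-highGood : ∀ {j x} → x < suc r → HighGood j (inj₂ x)
  other-highGood {j} (s≤s x≤r) = x≤r , ≤-trans x≤r (≤-trans (n≤1+n r) (m≤m+n (suc r) j))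

  matched⇒admissible : ∀ {w} → Matched w → Admissible (assemble w)
  matched⇒admissible {u , v} (half bu iu ou , half bv iv ov) =
    placement inj (proj₁ ∘ good) , proj₂ ∘ good
    where
    lowGood : ∀ k → LowGood (toℕ k) (lookup u k)
    lowGood k with lookup u k in eq
    ... | inj₁ x = own-lowGood (bu eq)
    ... | inj₂ y = other-lowGood {toℕ k} (proj₁ (ou eq))

    highGood : ∀ j → HighGood (toℕ j) (lookup v j)
    highGood j with lookup v j in eq
    ... | inj₁ y = own-highGood (bv eq)
    ... | inj₂ x = other-highGood {toℕ j} (proj₁ (ov eq))

    good : ∀ c → InRange (lookup (assemble (u , v)) c) × Allowed (toℕ c) (lookup (assemble (u , v)) c)
    good c with chipView c
    ... | low k  rewrite lookup-low u v k | toℕ-lowChip k = lowGood k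
    ... | high j rewrite lookup-high u v j | toℕ-highChip j = highGood j

    -- A slot held by both halves would be an own slot of one and a foreign slot of the other, which
    -- `other` excludes.
    cross : ∀ k j → Sum.swap (lookup u k) ≢ lookup v j
    cross k j eq with lookup u k in eu
    ... | inj₁ x = proj₂ (ov (sym eq)) (k , own-lookup u eu)
    ... | inj₂ y = proj₂ (ou eu) (j , own-lookup v (sym eq))

    inj : InjectiveVec (assemble (u , v))
    inj {c} {d} eq with chipView c | chipView d
    ... | low k  | low l  = cong lowChip (iu (swap-injective
      (trans (sym (lookup-low u v k)) (trans eq (lookup-low u v l)))))
    ... | low k  | high j = ⊥-elim (cross k j (trans (sym (lookup-low u v k)) (trans eq (lookup-high u v j))))
    ... | high j | low k  = ⊥-elim (cross k j (trans (sym (lookup-low u v k)) (trans (sym eq) (lookup-high u v j))))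
    ... | high i | high j = cong highChip (iv (trans (sym (lookup-high u v i)) (trans eq (lookup-high u v j))))

  admissible⇒matched : ∀ {w} → Admissible (assemble w) → Matched w
  admissible⇒matched {u , v} (P , allowed) =
    half (λ {k} eq → lowGood-own (subst (LowGood (toℕ k)) eq (lowGood k)) (s≤s⁻¹ (Finₚ.toℕ<n k)))
         (λ {k} {l} eq → lowChip-injective (injective P
           (trans (lookup-low u v k) (trans (cong Sum.swap eq) (sym (lookup-low u v l))))))
         (λ {k} eq → proj₁ (subst (LowGood (toℕ k)) eq (lowGood k)) ,
           λ (j , used) → cross k j (trans (cong Sum.swap eq) (sym (lookup-own v used)))) ,
    half (λ {j} eq → highGood-own (subst (HighGood (toℕ j)) eq (highGood j)))
         (λ {i} {j} eq → Finₚ.↑ʳ-injective (suc r) _ _ (injective P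
           (trans (lookup-high u v i) (trans eq (sym (lookup-high u v j))))))
         (λ {j} eq → s≤s (proj₁ (subst (HighGood (toℕ j)) eq (highGood j))) ,
           λ (k , used) → cross k j (trans (cong Sum.swap (lookup-own u used)) (sym eq)))
    where
    lowGood : ∀ k → LowGood (toℕ k) (lookup u k)
    lowGood k = subst InRange (lookup-low u v k) (inRange P (lowChip k)) ,
      subst₂ Allowed (toℕ-lowChip k) (lookup-low u v k) (allowed (lowChip k))

    highGood : ∀ j → HighGood (toℕ j) (lookup v j)
    highGood j = subst InRange (lookup-high u v j) (inRange P (highChip j)) ,
      subst₂ Allowed (toℕ-highChip j) (lookup-high u v j) (allowed (highChip j))

    cross : ∀ k j → Sum.swap (lookup u k) ≢ lookup v j
    cross k j eq = low≢high k j (injective P (trans (lookup-low u v k) (trans eq (sym (lookup-high u v j)))))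

  enum-admissible : ∀ {k} → Enum (Matched {suc r} {p}) k → Enum Admissible k
  enum-admissible M = enum-resp to from (enum-map assemble (λ _ _ → assemble-injective) M)
    where
    to : ∀ {E} → ∃[ w ] (Matched w × E ≡ assemble w) → Admissible E
    to (_ , M , refl) = matched⇒admissible M

    from : ∀ {E} → Admissible E → ∃[ w ] (Matched w × E ≡ assemble w)
    from {E} A with disassemble E
    ... | w , refl = w , admissible⇒matched A , refl

  sorting-configurations : ∀ {k} → Enum (Matched {suc r} {p}) k →
    ∃[ xs ] (Unique xs × (∀ (C : Config n) → (C ∈ xs) ⇔ (InS n p C × Toppleable n C)) × 2 * length xs ≡ k)
  sorting-configurations M = listing (enum-toppleable (enum-admissible M))
    where
    listing : ∀ {k} → ∃[ i ] (Enum (λ C → InS n p C × Toppleable n C) i × 2 * i ≡ k) →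
      ∃[ xs ] (Unique xs × (∀ (C : Config n) → (C ∈ xs) ⇔ (InS n p C × Toppleable n C)) × 2 * length xs ≡ k)
    listing (i , enum xs u s c refl , eq) = xs , u , (λ C → mk⇔ s c) , eq

theorem2p4 : (n p : ℕ) → 1 ≤ n → 1 ≤ p → p ≤ n →
    ∃[ xs ] (Unique xs ×
    (∀ (C : Config n) → (C ∈ xs) ⇔ (InS n p C × Toppleable n C)) ×
    2 * length xs ≡ polyBernoulliB (n ∸ p + 1) p)
theorem2p4 n p _ 1≤p p≤n =
  -- Here `r` is `n ∸ p`, so the halves have `suc (n ∸ p)` and `p` rows; the two transports restore
  -- `n` and the form `n ∸ p + 1`.
  subst (λ n′ → Claim n′ (n ∸ p + 1)) (m∸n+n≡m p≤n)
    (subst (Claim (n ∸ p + p)) (+-comm 1 (n ∸ p))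
      (Slots.sorting-configurations (n ∸ p) p 1≤p (enum-matched (suc (n ∸ p)) p)))
  where
  Claim : ℕ → ℕ → Set
  Claim n t = ∃[ xs ] (Unique xs × (∀ (C : Config n) → (C ∈ xs) ⇔ (InS n p C × Toppleable n C)) ×
                       2 * length xs ≡ polyBernoulliB t p)
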